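{- Let $\Phi$ be an $m\times n$ matrix with entries in $\{0,1\}$ such that every column contains exactly $d$ ones, and let $G=(A,B,E)$ be the bipartite graph with $A=\{1,\dots,n\}$ (columns), $B=\{1,\dots,m\}$ (rows) and $(i,j)\in E$ iff $\Phi_{j,i}=1$. Suppose that for some scaling factor $S>0$ the matrix $S\Phi$ satisfies the $\mathrm{RIP}_{1,s,\delta}$ property. Then $G$ (whose adjacency matrix is $\Phi$) is an $(s,\epsilon)$-unbalanced expander with $$\epsilon=\Big(1-\frac{1}{1+\delta}\Big)\Big/\big(2-\sqrt2\big).$$
   Context: An $m\times n$ matrix $M$ satisfies $\mathrm{RIP}_{p,k,\delta}$ if for every $k$-sparse $x\in\mathbb{R}^n$ (at most $k$ nonzero coordinates), $\|x\|_p\le\|Mx\|_p\le(1+\delta)\|x\|_p$. A $(k,\epsilon)$-unbalanced expander is a simple bipartite graph $G=(A,B,E)$ in which every vertex of $A$ has exactly $d$ neighbours (left degree $d$) such that for every $X\subseteq A$ with $|X|\le k$, the neighbourhood $N(X)\subseteq B$ satisfies $|N(X)|\ge(1-\epsilon)d|X|$. -}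

module Defs where

open import Data.Fin.Base using (Fin; zero; suc; toℕ)
open import Data.Fin.Properties as Fin using (any?)
open import Data.Fin.Subset using (Subset; ∣_∣; _∉_)
open import Data.Fin.Subset.Properties using (_∈?_)
import Data.Integer.Base as ℤ
import Data.Integer.Properties as ℤ
open import Data.Nat.Base as ℕ using (ℕ; zero; suc)
import Data.Nat.Properties as ℕ
open import Data.Product.Base using (_×_; _,_; ∃-syntax)
open import Data.Rational.Base as ℚ using (ℚ; 0ℚ; 1ℚ; ½)
import Data.Rational.Properties as ℚ
import Data.Rational.Unnormalised.Base as ℚᵘ
import Data.Rational.Unnormalised.Properties as ℚᵘ
open import Data.Rational.Solver using (module +-*-Solver)
open import Data.Sum.Base using (_⊎_; inj₁; inj₂)
open import Data.Vec.Base using (tabulate)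
open import Data.Vec.Functional using (Vector; foldr)
open import Level using (0ℓ)
open import Relation.Binary.Core using (REL)
open import Relation.Binary.Definitions using (Decidable)
open import Relation.Binary.PropositionalEquality
open import Relation.Nullary.Decidable using (yes; no; does; _×-dec_; from-yes)
open import Relation.Nullary.Negation using (contradiction)
import Relation.Unary as U

-- The library has no real numbers, so ℝ is constructed as the setoid of
-- Cauchy sequences of rationals.

module RationalLemmas where
  open import Data.Rational.Base using (_+_; _*_; _-_; -_; _≤_; _<_)
  open ℚ.≤-Reasoning
  open +-*-Solver

  0<½ : 0ℚ < ½
  0<½ = from-yes (0ℚ ℚ.<? ½)

  0<1 : 0ℚ < 1ℚ
  0<1 = from-yes (0ℚ ℚ.<? 1ℚ)

  0<* : ∀ {p q} → 0ℚ < p → 0ℚ < q → 0ℚ < p * q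
  0<* {p} {q} 0<p 0<q =
    ℚ.positive⁻¹ (p * q) {{ℚ.pos*pos⇒pos p {{ℚ.positive 0<p}} q {{ℚ.positive 0<q}}}}

  0≤+ : ∀ {p q} → 0ℚ ≤ p → 0ℚ ≤ q → 0ℚ ≤ p + q
  0≤+ {p} {q} 0≤p 0≤q = ℚ.nonNegative⁻¹ (p + q)
    {{ℚ.nonNeg+nonNeg⇒nonNeg p {{ℚ.nonNegative 0≤p}} q {{ℚ.nonNegative 0≤q}}}}

  *-monoˡ : ∀ r {p q} → 0ℚ ≤ r → p ≤ q → r * p ≤ r * q
  *-monoˡ r 0≤r = ℚ.*-monoˡ-≤-nonNeg r {{ℚ.nonNegative 0≤r}}

  *-monoʳ : ∀ r {p q} → 0ℚ ≤ r → p ≤ q → p * r ≤ q * r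
  *-monoʳ r 0≤r = ℚ.*-monoʳ-≤-nonNeg r {{ℚ.nonNegative 0≤r}}

  *-mono-≤ : ∀ {p q r s} → 0ℚ ≤ p → 0ℚ ≤ s → p ≤ q → r ≤ s → p * r ≤ q * s
  *-mono-≤ {p} {q} {r} {s} 0≤p 0≤s p≤q r≤s =
    ℚ.≤-trans (*-monoˡ p 0≤p r≤s) (*-monoʳ s 0≤s p≤q)

  p≤∣p∣ : ∀ p → p ≤ ℚ.∣ p ∣
  p≤∣p∣ p with ℚ.≤-total 0ℚ p
  ... | inj₁ 0≤p = ℚ.≤-reflexive (sym (ℚ.0≤p⇒∣p∣≡p 0≤p))
  ... | inj₂ p≤0 = ℚ.≤-trans p≤0 (ℚ.0≤∣p∣ p)

  -p≤∣p∣ : ∀ p → - p ≤ ℚ.∣ p ∣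
  -p≤∣p∣ p = subst (- p ≤_) (ℚ.∣-p∣≡∣p∣ p) (p≤∣p∣ (- p))

  p+q≤0⇒q≤∣p∣ : ∀ {p q} → p + q ≤ 0ℚ → q ≤ ℚ.∣ p ∣
  p+q≤0⇒q≤∣p∣ {p} {q} h = begin
    q             ≡⟨ solve 2 (λ a b → b := (a :+ b) :- a) refl p q ⟩
    (p + q) - p   ≤⟨ ℚ.+-monoˡ-≤ (- p) h ⟩
    0ℚ - p        ≡⟨ ℚ.+-identityˡ (- p) ⟩
    - p           ≤⟨ -p≤∣p∣ p ⟩
    ℚ.∣ p ∣       ∎

  ∣p∣≤ : ∀ {p q} → p ≤ q → - p ≤ q → ℚ.∣ p ∣ ≤ q
  ∣p∣≤ {p} {q} p≤q -p≤q with ℚ.∣p∣≡p∨∣p∣≡-p p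
  ... | inj₁ eq = subst (_≤ q) (sym eq) p≤q
  ... | inj₂ eq = subst (_≤ q) (sym eq) -p≤q

  ∣-∣-swap : ∀ p q → ℚ.∣ p - q ∣ ≡ ℚ.∣ q - p ∣
  ∣-∣-swap p q = trans (sym (ℚ.∣-p∣≡∣p∣ (p - q)))
    (cong ℚ.∣_∣ (solve 2 (λ a b → :- (a :- b) := b :- a) refl p q))

  ∣p∣≤∣q∣+∣p-q∣ : ∀ p q → ℚ.∣ p ∣ ≤ ℚ.∣ q ∣ + ℚ.∣ p - q ∣
  ∣p∣≤∣q∣+∣p-q∣ p q = begin
    ℚ.∣ p ∣             ≡⟨ cong ℚ.∣_∣ (solve 2 (λ a b → a := b :+ (a :- b)) refl p q) ⟩
    ℚ.∣ q + (p - q) ∣   ≤⟨ ℚ.∣p+q∣≤∣p∣+∣q∣ q (p - q) ⟩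
    ℚ.∣ q ∣ + ℚ.∣ p - q ∣ ∎

  p≤q+r⇒p-q≤r : ∀ {p} q {r} → p ≤ q + r → p - q ≤ r
  p≤q+r⇒p-q≤r {p} q {r} h = begin
    p - q       ≤⟨ ℚ.+-monoˡ-≤ (- q) h ⟩
    q + r - q   ≡⟨ solve 2 (λ a b → a :+ b :- a := b) refl q r ⟩
    r           ∎

  ∣∣p∣-∣q∣∣≤∣p-q∣ : ∀ p q → ℚ.∣ ℚ.∣ p ∣ - ℚ.∣ q ∣ ∣ ≤ ℚ.∣ p - q ∣
  ∣∣p∣-∣q∣∣≤∣p-q∣ p q = ∣p∣≤ (p≤q+r⇒p-q≤r ℚ.∣ q ∣ (∣p∣≤∣q∣+∣p-q∣ p q)) (begin
    - (ℚ.∣ p ∣ - ℚ.∣ q ∣) ≡⟨ solve 2 (λ a b → :- (a :- b) := b :- a) refl ℚ.∣ p ∣ ℚ.∣ q ∣ ⟩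
    ℚ.∣ q ∣ - ℚ.∣ p ∣     ≤⟨ p≤q+r⇒p-q≤r ℚ.∣ p ∣ (∣p∣≤∣q∣+∣p-q∣ q p) ⟩
    ℚ.∣ q - p ∣           ≡⟨ ∣-∣-swap q p ⟩
    ℚ.∣ p - q ∣           ∎)

  recip : ℚ → ℚ
  recip p with p ℚ.≟ 0ℚ
  ... | yes _   = 0ℚ
  ... | no  p≢0 = (ℚ.1/ p) {{ℚ.≢-nonZero p≢0}}

  *-recip : ∀ {p} → p ≢ 0ℚ → p * recip p ≡ 1ℚ
  *-recip {p} p≢0 with p ℚ.≟ 0ℚ
  ... | yes p≡0 = contradiction p≡0 p≢0
  ... | no  q   = ℚ.*-inverseʳ p {{ℚ.≢-nonZero q}}

  0<⇒≢0 : ∀ {p} → 0ℚ < p → p ≢ 0ℚ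
  0<⇒≢0 0<p p≡0 = ℚ.<⇒≢ 0<p (sym p≡0)

  0<recip : ∀ {p} → 0ℚ < p → 0ℚ < recip p
  0<recip {p} 0<p = ℚ.*-cancelˡ-<-nonNeg p {{ℚ.nonNegative (ℚ.<⇒≤ 0<p)}}
    (subst₂ _<_ (sym (ℚ.*-zeroʳ p)) (sym (*-recip (0<⇒≢0 0<p))) 0<1)

  ∣recip∣≤ : ∀ {c p} → 0ℚ < c → c ≤ ℚ.∣ p ∣ → p ≢ 0ℚ → ℚ.∣ recip p ∣ ≤ recip c
  ∣recip∣≤ {c} {p} 0<c c≤∣p∣ p≢0 = ℚ.*-cancelˡ-≤-pos c {{ℚ.positive 0<c}} (begin
    c * ℚ.∣ recip p ∣         ≤⟨ *-monoʳ ℚ.∣ recip p ∣ (ℚ.0≤∣p∣ (recip p)) c≤∣p∣ ⟩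
    ℚ.∣ p ∣ * ℚ.∣ recip p ∣   ≡⟨ sym (ℚ.∣p*q∣≡∣p∣*∣q∣ p (recip p)) ⟩
    ℚ.∣ p * recip p ∣         ≡⟨ cong ℚ.∣_∣ (*-recip p≢0) ⟩
    1ℚ                        ≡⟨ sym (*-recip (0<⇒≢0 0<c)) ⟩
    c * recip c               ∎)

  ∣p∣>0⇒p≢0 : ∀ {c p} → 0ℚ < c → c ≤ ℚ.∣ p ∣ → p ≢ 0ℚ
  ∣p∣>0⇒p≢0 0<c c≤ refl = ℚ.<-irrefl refl (ℚ.<-≤-trans 0<c c≤)

  p*p≤q*q : ∀ {p q} → 0ℚ ≤ p → p ≤ q → p * p ≤ q * q
  p*p≤q*q 0≤p p≤q = *-mono-≤ 0≤p (ℚ.≤-trans 0≤p p≤q) p≤q p≤q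

  p*p<q*q⇒p<q : ∀ {p q} → 0ℚ ≤ q → p * p < q * q → p < q
  p*p<q*q⇒p<q {p} {q} 0≤q lt with p ℚ.<? q
  ... | yes p<q = p<q
  ... | no  p≮q = contradiction (ℚ.<-≤-trans lt (p*p≤q*q 0≤q (ℚ.≮⇒≥ p≮q))) (ℚ.<-irrefl refl)

  ½*p+½*p≡p : ∀ p → ½ * p + ½ * p ≡ p
  ½*p+½*p≡p = solve 1 (λ a → con ½ :* a :+ con ½ :* a := a) refl

  half^ : ℕ → ℚ
  half^ zero    = 1ℚ
  half^ (suc n) = ½ * half^ n

  0<half^ : ∀ n → 0ℚ < half^ n
  0<half^ zero    = 0<1
  0<half^ (suc n) = 0<* 0<½ (0<half^ n)

  half^-step : ∀ n → half^ (suc n) ≤ half^ n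
  half^-step n = begin
    ½ * half^ n                  ≡⟨ ℚ.+-identityʳ (½ * half^ n) ⟨
    ½ * half^ n + 0ℚ             ≤⟨ ℚ.+-monoʳ-≤ (½ * half^ n) (ℚ.<⇒≤ (0<half^ (suc n))) ⟩
    ½ * half^ n + ½ * half^ n    ≡⟨ ½*p+½*p≡p (half^ n) ⟩
    half^ n                      ∎

  half^-antimono′ : ∀ {m n} → m ℕ.≤′ n → half^ n ≤ half^ m
  half^-antimono′ (ℕ.≤′-reflexive refl) = ℚ.≤-refl
  half^-antimono′ {n = suc n} (ℕ.≤′-step m≤n) = ℚ.≤-trans (half^-step n) (half^-antimono′ m≤n)

  half^-antimono : ∀ {m n} → m ℕ.≤ n → half^ n ≤ half^ m
  half^-antimono m≤n = half^-antimono′ (ℕ.≤⇒≤′ m≤n)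

  half^≤1 : ∀ n → half^ n ≤ 1ℚ
  half^≤1 n = half^-antimono {0} {n} ℕ.z≤n

  ⌜_⌝ : ℕ → ℚ
  ⌜ n ⌝ = ℤ.+ n ℚ./ 1

  ⌜suc⌝ : ∀ n → ⌜ suc n ⌝ ≡ 1ℚ + ⌜ n ⌝
  ⌜suc⌝ n = ℚ.toℚᵘ-injective (ℚᵘ.≃-trans (ℚ.toℚᵘ-fromℚᵘ (ℚᵘ.mkℚᵘ (ℤ.+ suc n) 0))
    (ℚᵘ.≃-sym (ℚᵘ.≃-trans (ℚ.toℚᵘ-homo-+ 1ℚ ⌜ n ⌝)
      (ℚᵘ.≃-trans (ℚᵘ.+-congʳ (ℚ.toℚᵘ 1ℚ) (ℚ.toℚᵘ-fromℚᵘ (ℚᵘ.mkℚᵘ (ℤ.+ n) 0)))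
        (ℚᵘ.*≡* (cong (λ i → (ℤ.1ℤ ℤ.+ i) ℤ.* ℤ.1ℤ) (ℤ.*-identityʳ (ℤ.+ n))))))))

  0≤⌜⌝ : ∀ n → 0ℚ ≤ ⌜ n ⌝
  0≤⌜⌝ n = ℚ.nonNegative⁻¹ ⌜ n ⌝ {{ℚ.normalize-nonNeg n 1}}

  ⌜1+n⌝*half^≤1 : ∀ n → ⌜ suc n ⌝ * half^ n ≤ 1ℚ
  ⌜1+n⌝*half^≤1 zero    = ℚ.≤-refl
  ⌜1+n⌝*half^≤1 (suc n) = begin
    ⌜ suc (suc n) ⌝ * (½ * h)                    ≡⟨ cong (_* (½ * h)) (⌜suc⌝ (suc n)) ⟩
    (1ℚ + ⌜ suc n ⌝) * (½ * h)                   ≤⟨ *-monoʳ (½ * h) (ℚ.<⇒≤ (0<half^ (suc n)))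
                                                      (ℚ.+-monoˡ-≤ ⌜ suc n ⌝ 1≤) ⟩
    (⌜ suc n ⌝ + ⌜ suc n ⌝) * (½ * h)            ≡⟨ solve 2 (λ a b → (a :+ a) :* (con ½ :* b) := a :* b) refl ⌜ suc n ⌝ h ⟩
    ⌜ suc n ⌝ * h                                ≤⟨ ⌜1+n⌝*half^≤1 n ⟩
    1ℚ                                           ∎
    where
    h = half^ n
    1≤ : 1ℚ ≤ ⌜ suc n ⌝
    1≤ = begin
      1ℚ           ≡⟨ ℚ.+-identityʳ 1ℚ ⟨
      1ℚ + 0ℚ      ≤⟨ ℚ.+-monoʳ-≤ 1ℚ (0≤⌜⌝ n) ⟩
      1ℚ + ⌜ n ⌝   ≡⟨ ⌜suc⌝ n ⟨
      ⌜ suc n ⌝    ∎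

  1≤ε*↧ : ∀ ε → 0ℚ < ε → 1ℚ ≤ ε * ⌜ ℚ.↧ₙ ε ⌝
  1≤ε*↧ ε@(ℚ.mkℚ p d-1 _) 0<ε = ℚ.toℚᵘ-cancel-≤
    (ℚᵘ.≤-respʳ-≃
      (ℚᵘ.≃-sym (ℚᵘ.≃-trans (ℚ.toℚᵘ-homo-* ε ⌜ suc d-1 ⌝)
        (ℚᵘ.*-congˡ {ℚ.toℚᵘ ε} (ℚ.toℚᵘ-fromℚᵘ (ℚᵘ.mkℚᵘ (ℤ.+ suc d-1) 0)))))
      (go p (ℚ.positive 0<ε)))
    where
    go : ∀ p → ℚᵘ.Positive (ℚᵘ.mkℚᵘ p d-1) →
         ℚᵘ.1ℚᵘ ℚᵘ.≤ ℚᵘ.mkℚᵘ p d-1 ℚᵘ.* ℚᵘ.mkℚᵘ (ℤ.+ suc d-1) 0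
    go (ℤ.+ suc k) _ = ℚᵘ.*≤* (subst₂ ℤ._≤_
      (trans (cong ℤ.+_ (sym (ℕ.*-identityʳ (suc d-1)))) (sym (ℤ.*-identityˡ (ℤ.+ (suc d-1 ℕ.* 1)))))
      (trans (ℤ.pos-* (suc k) (suc d-1)) (sym (ℤ.*-identityʳ (ℤ.+ suc k ℤ.* ℤ.+ suc d-1))))
      (ℤ.+≤+ (ℕ.m≤n*m (suc d-1) (suc k))))

  half^-small : ∀ ε → 0ℚ < ε → ∃[ N ] half^ N ≤ ε
  half^-small ε 0<ε = ℚ.↧ₙ ε , (begin
      half^ d                       ≡⟨ ℚ.*-identityˡ (half^ d) ⟨
      1ℚ * half^ d                  ≤⟨ *-monoʳ (half^ d) (ℚ.<⇒≤ (0<half^ d)) (1≤ε*↧ ε 0<ε) ⟩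
      (ε * ⌜ d ⌝) * half^ d         ≤⟨ *-monoʳ (half^ d) (ℚ.<⇒≤ (0<half^ d)) (*-monoˡ ε 0≤ε d≤) ⟩
      (ε * ⌜ suc d ⌝) * half^ d     ≡⟨ ℚ.*-assoc ε ⌜ suc d ⌝ (half^ d) ⟩
      ε * (⌜ suc d ⌝ * half^ d)     ≤⟨ *-monoˡ ε 0≤ε (⌜1+n⌝*half^≤1 d) ⟩
      ε * 1ℚ                        ≡⟨ ℚ.*-identityʳ ε ⟩
      ε                             ∎)
    where
    d = ℚ.↧ₙ ε
    0≤ε = ℚ.<⇒≤ 0<ε
    d≤ : ⌜ d ⌝ ≤ ⌜ suc d ⌝
    d≤ = begin
      ⌜ d ⌝        ≡⟨ ℚ.+-identityˡ ⌜ d ⌝ ⟨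
      0ℚ + ⌜ d ⌝   ≤⟨ ℚ.+-monoˡ-≤ ⌜ d ⌝ (ℚ.<⇒≤ 0<1) ⟩
      1ℚ + ⌜ d ⌝   ≡⟨ ⌜suc⌝ d ⟨
      ⌜ suc d ⌝    ∎

Eventually : (ℕ → Set) → Set
Eventually P = ∃[ N ] ∀ n → N ℕ.≤ n → P n

IsCauchy : (ℕ → ℚ) → Set
IsCauchy f = ∀ ε → 0ℚ ℚ.< ε →
  ∃[ N ] ∀ m n → N ℕ.≤ m → N ℕ.≤ n → ℚ.∣ f m ℚ.- f n ∣ ℚ.≤ ε

module CauchyLemmas where
  open RationalLemmas
  open import Data.Rational.Base using (_+_; _*_; _-_; -_; _≤_; _<_)
  open ℚ.≤-Reasoning
  open +-*-Solver

  abstract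
    const-cauchy : ∀ q → IsCauchy (λ _ → q)
    const-cauchy q ε 0<ε = 0 , λ _ _ _ _ →
      subst (λ p → ℚ.∣ p ∣ ≤ ε) (sym (ℚ.+-inverseʳ q)) (ℚ.<⇒≤ 0<ε)

    halve : ∀ {ε p q} → p ≤ ½ * ε → q ≤ ½ * ε → p + q ≤ ε
    halve {ε} {p} {q} hp hq = begin
      p + q             ≤⟨ ℚ.+-mono-≤ hp hq ⟩
      ½ * ε + ½ * ε     ≡⟨ ½*p+½*p≡p ε ⟩
      ε                 ∎

    +-cauchy : ∀ f g → IsCauchy f → IsCauchy g → IsCauchy (λ n → f n + g n)
    +-cauchy f g cf cg ε 0<ε
      with cf (½ * ε) (0<* 0<½ 0<ε) | cg (½ * ε) (0<* 0<½ 0<ε)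
    ... | M , hf | N , hg = M ℕ.⊔ N , λ m n ≤m ≤n → begin
      ℚ.∣ (f m + g m) - (f n + g n) ∣
        ≡⟨ cong ℚ.∣_∣ (solve 4 (λ a b c d → (a :+ b) :- (c :+ d) := (a :- c) :+ (b :- d)) refl
             (f m) (g m) (f n) (g n)) ⟩
      ℚ.∣ (f m - f n) + (g m - g n) ∣
        ≤⟨ ℚ.∣p+q∣≤∣p∣+∣q∣ (f m - f n) (g m - g n) ⟩
      ℚ.∣ f m - f n ∣ + ℚ.∣ g m - g n ∣
        ≤⟨ halve (hf m n (ℕ.≤-trans (ℕ.m≤m⊔n M N) ≤m) (ℕ.≤-trans (ℕ.m≤m⊔n M N) ≤n))
                 (hg m n (ℕ.≤-trans (ℕ.m≤n⊔m M N) ≤m) (ℕ.≤-trans (ℕ.m≤n⊔m M N) ≤n)) ⟩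
      ε ∎

    neg-cauchy : ∀ f → IsCauchy f → IsCauchy (λ n → - f n)
    neg-cauchy f cf ε 0<ε with cf ε 0<ε
    ... | N , h = N , λ m n ≤m ≤n → begin
      ℚ.∣ - f m - - f n ∣   ≡⟨ cong ℚ.∣_∣ (solve 2 (λ a b → :- a :- :- b := b :- a) refl (f m) (f n)) ⟩
      ℚ.∣ f n - f m ∣       ≤⟨ h n m ≤n ≤m ⟩
      ε                     ∎

    abs-cauchy : ∀ f → IsCauchy f → IsCauchy (λ n → ℚ.∣ f n ∣)
    abs-cauchy f cf ε 0<ε with cf ε 0<ε
    ... | N , h = N , λ m n ≤m ≤n → ℚ.≤-trans (∣∣p∣-∣q∣∣≤∣p-q∣ (f m) (f n)) (h m n ≤m ≤n)

    bound : ∀ f → IsCauchy f → ∃[ B ] (0ℚ < B × Eventually λ n → ℚ.∣ f n ∣ ≤ B)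
    bound f cf with cf 1ℚ 0<1
    ... | N , h = ℚ.∣ f N ∣ + 1ℚ , ℚ.+-mono-≤-< (ℚ.0≤∣p∣ (f N)) 0<1 , N , λ n ≤n →
      ℚ.≤-trans (∣p∣≤∣q∣+∣p-q∣ (f n) (f N)) (ℚ.+-monoʳ-≤ ℚ.∣ f N ∣ (h n N ≤n ℕ.≤-refl))

    scale : ∀ {B} → 0ℚ < B → ∀ ε → B * (recip B * ε) ≡ ε
    scale {B} 0<B ε = trans (sym (ℚ.*-assoc B (recip B) ε))
      (trans (cong (_* ε) (*-recip (0<⇒≢0 0<B))) (ℚ.*-identityˡ ε))

    prod≤ : ∀ {B ε p q} → 0ℚ < B → 0ℚ ≤ p → 0ℚ < ε → p ≤ B → q ≤ recip B * ε → p * q ≤ ε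
    prod≤ {B} {ε} {p} {q} 0<B 0≤p 0<ε p≤B q≤ = begin
      p * q               ≤⟨ *-mono-≤ 0≤p (ℚ.<⇒≤ (0<* (0<recip 0<B) 0<ε)) p≤B q≤ ⟩
      B * (recip B * ε)   ≡⟨ scale 0<B ε ⟩
      ε                   ∎

    *-expand : ∀ a b c d → a * b - c * d ≡ a * (b - d) + d * (a - c)
    *-expand = solve 4 (λ a b c d → a :* b :- c :* d := a :* (b :- d) :+ d :* (a :- c)) refl

    *-close : ∀ {B C ε} a b c d → 0ℚ < B → 0ℚ < C → 0ℚ < ε → ℚ.∣ a ∣ ≤ B → ℚ.∣ d ∣ ≤ C →
              ℚ.∣ a - c ∣ ≤ recip C * (½ * ε) → ℚ.∣ b - d ∣ ≤ recip B * (½ * ε) →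
              ℚ.∣ a * b - c * d ∣ ≤ ε
    *-close {ε = ε} a b c d 0<B 0<C 0<ε a≤ d≤ a-c≤ b-d≤ = begin
      ℚ.∣ a * b - c * d ∣                             ≡⟨ cong ℚ.∣_∣ (*-expand a b c d) ⟩
      ℚ.∣ a * (b - d) + d * (a - c) ∣                 ≤⟨ ℚ.∣p+q∣≤∣p∣+∣q∣ (a * (b - d)) (d * (a - c)) ⟩
      ℚ.∣ a * (b - d) ∣ + ℚ.∣ d * (a - c) ∣           ≡⟨ cong₂ _+_ (ℚ.∣p*q∣≡∣p∣*∣q∣ a (b - d)) (ℚ.∣p*q∣≡∣p∣*∣q∣ d (a - c)) ⟩
      ℚ.∣ a ∣ * ℚ.∣ b - d ∣ + ℚ.∣ d ∣ * ℚ.∣ a - c ∣   ≤⟨ halve (prod≤ 0<B (ℚ.0≤∣p∣ a) 0<½ε a≤ b-d≤)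
                                                                 (prod≤ 0<C (ℚ.0≤∣p∣ d) 0<½ε d≤ a-c≤) ⟩
      ε                                               ∎
      where
      0<½ε : 0ℚ < ½ * ε
      0<½ε = 0<* 0<½ 0<ε

    *-cauchy : ∀ f g → IsCauchy f → IsCauchy g → IsCauchy (λ n → f n * g n)
    *-cauchy f g cf cg ε 0<ε =
      let B , 0<B , K , hB = bound f cf
          C , 0<C , L , hC = bound g cg
          M , hf = cf (recip C * (½ * ε)) (0<* (0<recip 0<C) (0<* 0<½ 0<ε))
          N , hg = cg (recip B * (½ * ε)) (0<* (0<recip 0<B) (0<* 0<½ 0<ε))
          J  = (K ℕ.⊔ L) ℕ.⊔ (M ℕ.⊔ N)
          KL≤J = ℕ.m≤m⊔n (K ℕ.⊔ L) (M ℕ.⊔ N)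
          MN≤J = ℕ.m≤n⊔m (K ℕ.⊔ L) (M ℕ.⊔ N)
          K≤J = ℕ.≤-trans (ℕ.m≤m⊔n K L) KL≤J
          L≤J = ℕ.≤-trans (ℕ.m≤n⊔m K L) KL≤J
          M≤J = ℕ.≤-trans (ℕ.m≤m⊔n M N) MN≤J
          N≤J = ℕ.≤-trans (ℕ.m≤n⊔m M N) MN≤J
      in J , λ m n J≤m J≤n →
        *-close (f m) (g m) (f n) (g n) 0<B 0<C 0<ε
          (hB m (ℕ.≤-trans K≤J J≤m)) (hC n (ℕ.≤-trans L≤J J≤n))
          (hf m n (ℕ.≤-trans M≤J J≤m) (ℕ.≤-trans M≤J J≤n))
          (hg m n (ℕ.≤-trans N≤J J≤m) (ℕ.≤-trans N≤J J≤n))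

    recip-diff : ∀ {p q} → p ≢ 0ℚ → q ≢ 0ℚ → recip p - recip q ≡ (recip p * recip q) * (q - p)
    recip-diff {p} {q} p≢0 q≢0 = begin-equality
      a - b                       ≡⟨ cong₂ _-_ (ℚ.*-identityʳ a) (ℚ.*-identityʳ b) ⟨
      a * 1ℚ - b * 1ℚ             ≡⟨ cong₂ (λ s t → a * s - b * t) (*-recip q≢0) (*-recip p≢0) ⟨
      a * (q * b) - b * (p * a)   ≡⟨ solve 4 (λ a b x y → a :* (y :* b) :- b :* (x :* a)
                                                            := (a :* b) :* (y :- x)) refl a b p q ⟩
      (a * b) * (q - p)           ∎
      where
      a : ℚ
      a = recip p
      b : ℚ
      b = recip q

    scale² : ∀ {c} → 0ℚ < c → ∀ ε → (recip c * recip c) * ((c * c) * ε) ≡ ε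
    scale² {c} 0<c ε = begin-equality
      (C * C) * ((c * c) * ε)   ≡⟨ solve 3 (λ C c e → (C :* C) :* ((c :* c) :* e)
                                                        := ((c :* C) :* (c :* C)) :* e) refl C c ε ⟩
      ((c * C) * (c * C)) * ε   ≡⟨ cong (λ t → (t * t) * ε) (*-recip (0<⇒≢0 0<c)) ⟩
      1ℚ * ε                    ≡⟨ ℚ.*-identityˡ ε ⟩
      ε                         ∎
      where
      C : ℚ
      C = recip c

    recip-close : ∀ {c ε p q} → 0ℚ < c → c ≤ ℚ.∣ p ∣ → c ≤ ℚ.∣ q ∣ →
                  ℚ.∣ q - p ∣ ≤ (c * c) * ε → ℚ.∣ recip p - recip q ∣ ≤ ε
    recip-close {c} {ε} {p} {q} 0<c c≤p c≤q h = begin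
      ℚ.∣ a - b ∣
        ≡⟨ cong ℚ.∣_∣ (recip-diff p≢0 q≢0) ⟩
      ℚ.∣ (a * b) * (q - p) ∣
        ≡⟨ trans (ℚ.∣p*q∣≡∣p∣*∣q∣ (a * b) (q - p))
                 (cong (_* ℚ.∣ q - p ∣) (ℚ.∣p*q∣≡∣p∣*∣q∣ a b)) ⟩
      (ℚ.∣ a ∣ * ℚ.∣ b ∣) * ℚ.∣ q - p ∣
        ≤⟨ *-monoʳ ℚ.∣ q - p ∣ (ℚ.0≤∣p∣ (q - p))
             (*-mono-≤ (ℚ.0≤∣p∣ a) (ℚ.<⇒≤ (0<recip 0<c)) (∣recip∣≤ 0<c c≤p p≢0) (∣recip∣≤ 0<c c≤q q≢0)) ⟩
      (C * C) * ℚ.∣ q - p ∣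
        ≤⟨ *-monoˡ (C * C) (ℚ.<⇒≤ (0<* (0<recip 0<c) (0<recip 0<c))) h ⟩
      (C * C) * ((c * c) * ε)
        ≡⟨ scale² 0<c ε ⟩
      ε ∎
      where
      a : ℚ
      a = recip p
      b : ℚ
      b = recip q
      C : ℚ
      C = recip c
      p≢0 : p ≢ 0ℚ
      p≢0 = ∣p∣>0⇒p≢0 0<c c≤p
      q≢0 : q ≢ 0ℚ
      q≢0 = ∣p∣>0⇒p≢0 0<c c≤q

    recip-cauchy : ∀ f {c} → 0ℚ < c → (Eventually λ n → c ≤ ℚ.∣ f n ∣) →
                   IsCauchy f → IsCauchy (λ n → recip (f n))
    recip-cauchy f {c} 0<c (M , hc) cf ε 0<ε =
      let N , h = cf ((c * c) * ε) (0<* (0<* 0<c 0<c) 0<ε)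
      in M ℕ.⊔ N , λ m n ≤m ≤n → recip-close 0<c
        (hc m (ℕ.m⊔n≤o⇒m≤o M N ≤m)) (hc n (ℕ.m⊔n≤o⇒m≤o M N ≤n))
        (h n m (ℕ.m⊔n≤o⇒n≤o M N ≤n) (ℕ.m⊔n≤o⇒n≤o M N ≤m))

-- √2 by bisection: sqrt2 n is the largest multiple of 2⁻ⁿ whose square is
-- at most 2.

2ℚ : ℚ
2ℚ = ℤ.+ 2 ℚ./ 1

refine : ℚ → ℚ → ℚ
refine q h with (q ℚ.+ h) ℚ.* (q ℚ.+ h) ℚ.≤? 2ℚ
... | yes _ = q ℚ.+ h
... | no  _ = q

sqrt2 : ℕ → ℚ
sqrt2 zero    = 1ℚ
sqrt2 (suc n) = refine (sqrt2 n) (RationalLemmas.half^ (suc n))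

module Sqrt2Lemmas where
  open RationalLemmas
  open import Data.Rational.Base using (_+_; _*_; _-_; -_; _≤_; _<_)
  open ℚ.≤-Reasoning
  open +-*-Solver

  abstract
    refine-elim : ∀ (P : ℚ → Set) q h →
                  ((q + h) * (q + h) ≤ 2ℚ → P (q + h)) →
                  (2ℚ < (q + h) * (q + h) → P q) → P (refine q h)
    refine-elim P q h below above with (q + h) * (q + h) ℚ.≤? 2ℚ
    ... | yes p = below p
    ... | no ¬p = above (ℚ.≰⇒> ¬p)

    0≤sqrt2 : ∀ n → 0ℚ ≤ sqrt2 n
    0≤sqrt2 zero    = ℚ.<⇒≤ 0<1
    0≤sqrt2 (suc n) = refine-elim (0ℚ ≤_) (sqrt2 n) (half^ (suc n))
      (λ _ → 0≤+ {sqrt2 n} {half^ (suc n)} (0≤sqrt2 n) (ℚ.<⇒≤ (0<half^ (suc n))))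
      (λ _ → 0≤sqrt2 n)

    lower : ∀ n → sqrt2 n * sqrt2 n ≤ 2ℚ
    lower zero    = from-yes (1ℚ * 1ℚ ℚ.≤? 2ℚ)
    lower (suc n) = refine-elim (λ t → t * t ≤ 2ℚ) (sqrt2 n) (half^ (suc n))
      (λ h → h) (λ _ → lower n)

    upper : ∀ n → 2ℚ < (sqrt2 n + half^ n) * (sqrt2 n + half^ n)
    upper zero    = from-yes (2ℚ ℚ.<? (1ℚ + 1ℚ) * (1ℚ + 1ℚ))
    upper (suc n) = refine-elim (λ t → 2ℚ < (t + half^ (suc n)) * (t + half^ (suc n)))
      (sqrt2 n) (half^ (suc n))
      (λ _ → subst (λ t → 2ℚ < t * t) (sym eq) (upper n)) (λ h → h)
      where
      eq : (sqrt2 n + half^ (suc n)) + half^ (suc n) ≡ sqrt2 n + half^ n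
      eq = trans (ℚ.+-assoc (sqrt2 n) (half^ (suc n)) (half^ (suc n)))
        (cong (sqrt2 n +_) (½*p+½*p≡p (half^ n)))

    close : ∀ m n → sqrt2 m < sqrt2 n + half^ n
    close m n = p*p<q*q⇒p<q {sqrt2 m} {sqrt2 n + half^ n}
      (0≤+ {sqrt2 n} {half^ n} (0≤sqrt2 n) (ℚ.<⇒≤ (0<half^ n)))
      (ℚ.≤-<-trans (lower m) (upper n))

    diff : ∀ {ε} m n → half^ n ≤ ε → sqrt2 m - sqrt2 n ≤ ε
    diff {ε} m n h≤ε = p≤q+r⇒p-q≤r {sqrt2 m} (sqrt2 n) {ε}
      (ℚ.≤-trans {sqrt2 m} {sqrt2 n + half^ n} {sqrt2 n + ε}
        (ℚ.<⇒≤ (close m n)) (ℚ.+-monoʳ-≤ (sqrt2 n) {half^ n} {ε} h≤ε))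

    swap : ∀ a b → a - b ≡ - (b - a)
    swap = solve 2 (λ a b → a :- b := :- (b :- a)) refl

    ∣diff∣ : ∀ {ε} m n → half^ m ≤ ε → half^ n ≤ ε → ℚ.∣ sqrt2 m - sqrt2 n ∣ ≤ ε
    ∣diff∣ {ε} m n hm hn = ∣p∣≤ {sqrt2 m - sqrt2 n} {ε} (diff m n hn)
      (subst (_≤ ε) (swap (sqrt2 n) (sqrt2 m)) (diff n m hm))

    sqrt2-cauchy : IsCauchy sqrt2
    sqrt2-cauchy ε 0<ε =
      let N , h = half^-small ε 0<ε
      in N , λ m n ≤m ≤n → ∣diff∣ m n
        (ℚ.≤-trans (half^-antimono ≤m) h) (ℚ.≤-trans (half^-antimono ≤n) h)

    sqrt2≤3/2 : ∀ n → sqrt2 n ≤ 1ℚ + ½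
    sqrt2≤3/2 n = ℚ.<⇒≤ (p*p<q*q⇒p<q {sqrt2 n} {1ℚ + ½} (from-yes (0ℚ ℚ.≤? 1ℚ + ½))
      (ℚ.≤-<-trans (lower n) (from-yes (2ℚ ℚ.<? (1ℚ + ½) * (1ℚ + ½)))))

  ¼ 4ℚ : ℚ
  ¼  = ℤ.+ 1 ℚ./ 4
  4ℚ = ℤ.+ 4 ℚ./ 1

  abstract
    0<¼* : ∀ {ε} → 0ℚ < ε → 0ℚ < ¼ * ε
    0<¼* = 0<* (from-yes (0ℚ ℚ.<? ¼))

    4*¼* : ∀ ε → 4ℚ * (¼ * ε) ≡ ε
    4*¼* ε = trans (sym (ℚ.*-assoc 4ℚ ¼ ε)) (ℚ.*-identityˡ ε)

    expand-square : ∀ x h → (x + h) * (x + h) ≡ x * x + ((x + x) + h) * h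
    expand-square = solve 2 (λ x h → (x :+ h) :* (x :+ h) := x :* x :+ ((x :+ x) :+ h) :* h) refl

    square-gap : ∀ {x h ε} → 0ℚ ≤ x → x ≤ 1ℚ + ½ → 0ℚ ≤ h → h ≤ 1ℚ → h ≤ ¼ * ε →
                 2ℚ < (x + h) * (x + h) → 2ℚ ≤ x * x + ε
    square-gap {x} {h} {ε} 0≤x x≤ 0≤h h≤1 h≤ gt = begin
      2ℚ                          <⟨ gt ⟩
      (x + h) * (x + h)           ≡⟨ expand-square x h ⟩
      x * x + ((x + x) + h) * h   ≤⟨ ℚ.+-monoʳ-≤ (x * x) {((x + x) + h) * h} {4ℚ * (¼ * ε)}
                                       (*-mono-≤ {(x + x) + h} {4ℚ} {h} {¼ * ε} 0≤2x+h (ℚ.≤-trans 0≤h h≤) 2x+h≤4 h≤) ⟩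
      x * x + 4ℚ * (¼ * ε)        ≡⟨ cong (x * x +_) (4*¼* ε) ⟩
      x * x + ε                   ∎
      where
      0≤2x+h : 0ℚ ≤ (x + x) + h
      0≤2x+h = 0≤+ {x + x} {h} (0≤+ {x} {x} 0≤x 0≤x) 0≤h
      2x+h≤4 : (x + x) + h ≤ 4ℚ
      2x+h≤4 = ℚ.+-mono-≤ {x + x} {(1ℚ + ½) + (1ℚ + ½)} {h} {1ℚ}
        (ℚ.+-mono-≤ {x} {1ℚ + ½} {x} {1ℚ + ½} x≤ x≤) h≤1

    square-close : ∀ ε n → 0ℚ < ε → half^ n ≤ ¼ * ε → ℚ.∣ sqrt2 n * sqrt2 n - 2ℚ ∣ ≤ ε
    square-close ε n 0<ε h≤ = ∣p∣≤ {x * x - 2ℚ} {ε}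
      (p≤q+r⇒p-q≤r {x * x} 2ℚ {ε} (ℚ.≤-trans {x * x} {2ℚ} {2ℚ + ε} (lower n) 2≤2+ε))
      (subst (_≤ ε) (swap 2ℚ (x * x)) (p≤q+r⇒p-q≤r {2ℚ} (x * x) {ε}
        (square-gap {x} {half^ n} {ε} (0≤sqrt2 n) (sqrt2≤3/2 n)
          (ℚ.<⇒≤ (0<half^ n)) (half^≤1 n) h≤ (upper n))))
      where
      x : ℚ
      x = sqrt2 n
      2≤2+ε : 2ℚ ≤ 2ℚ + ε
      2≤2+ε = subst (_≤ 2ℚ + ε) (ℚ.+-identityʳ 2ℚ) (ℚ.+-monoʳ-≤ 2ℚ {0ℚ} {ε} (ℚ.<⇒≤ 0<ε))

record ℝ : Set where
  constructor mkℝ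
  field
    seq    : ℕ → ℚ
    cauchy : IsCauchy seq

open ℝ public

infix 4 _≈_ _≤_ _<_ _#_

record _≈_ (x y : ℝ) : Set where
  constructor mk≈
  field
    ≈-close : ∀ ε → 0ℚ ℚ.< ε → Eventually λ n → ℚ.∣ seq x n ℚ.- seq y n ∣ ℚ.≤ ε

record _≤_ (x y : ℝ) : Set where
  constructor mk≤
  field
    ≤-below : ∀ ε → 0ℚ ℚ.< ε → Eventually λ n → seq x n ℚ.≤ seq y n ℚ.+ ε

record _<_ (x y : ℝ) : Set where
  constructor mk<
  field
    gap   : ℚ
    0<gap : 0ℚ ℚ.< gap
    <-gap : Eventually λ n → seq x n ℚ.+ gap ℚ.≤ seq y n

open _≈_ public
open _≤_ public
open _<_ public

-- Apartness, the positive form of x ≠ y, which is what division needs.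
_#_ : ℝ → ℝ → Set
x # y = x < y ⊎ y < x

open CauchyLemmas
open Sqrt2Lemmas

infix  8 -_
infixl 7 _*_ _/_[_]
infixl 6 _+_ _-_

fromℚ : ℚ → ℝ
fromℚ q = mkℝ (λ _ → q) (const-cauchy q)

fromℕ : ℕ → ℝ
fromℕ n = fromℚ (ℤ.+ n ℚ./ 1)

0ℝ 1ℝ : ℝ
0ℝ = fromℚ 0ℚ
1ℝ = fromℚ 1ℚ

_+_ : ℝ → ℝ → ℝ
x + y = mkℝ (λ n → seq x n ℚ.+ seq y n) (+-cauchy (seq x) (seq y) (cauchy x) (cauchy y))

-_ : ℝ → ℝ
- x = mkℝ (λ n → ℚ.- seq x n) (neg-cauchy (seq x) (cauchy x))

_-_ : ℝ → ℝ → ℝ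
x - y = x + (- y)

_*_ : ℝ → ℝ → ℝ
x * y = mkℝ (λ n → seq x n ℚ.* seq y n) (*-cauchy (seq x) (seq y) (cauchy x) (cauchy y))

abs : ℝ → ℝ
abs x = mkℝ (λ n → ℚ.∣ seq x n ∣) (abs-cauchy (seq x) (cauchy x))

#0⇒bounded : ∀ {x} → x # 0ℝ → ∃[ c ] (0ℚ ℚ.< c × Eventually λ n → c ℚ.≤ ℚ.∣ seq x n ∣)
#0⇒bounded {x} (inj₁ (mk< c 0<c (N , h))) = c , 0<c , N , λ n ≤n →
  RationalLemmas.p+q≤0⇒q≤∣p∣ {seq x n} {c} (h n ≤n)
#0⇒bounded {x} (inj₂ (mk< c 0<c (N , h))) = c , 0<c , N , λ n ≤n →
  ℚ.≤-trans (subst (ℚ._≤ seq x n) (ℚ.+-identityˡ c) (h n ≤n)) (RationalLemmas.p≤∣p∣ (seq x n))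

_⁻¹[_] : (x : ℝ) → x # 0ℝ → ℝ
x ⁻¹[ x#0 ] = mkℝ (λ n → RationalLemmas.recip (seq x n))
  (let c , 0<c , ev = #0⇒bounded x#0 in recip-cauchy (seq x) 0<c ev (cauchy x))

_/_[_] : ℝ → (y : ℝ) → y # 0ℝ → ℝ
x / y [ y#0 ] = x * y ⁻¹[ y#0 ]

*-inverseʳ : ∀ x (x#0 : x # 0ℝ) → x * x ⁻¹[ x#0 ] ≈ 1ℝ
*-inverseʳ x x#0 = mk≈ λ ε 0<ε →
  let c , 0<c , N , h = #0⇒bounded x#0
  in N , λ n ≤n → subst (λ p → ℚ.∣ p ℚ.- 1ℚ ∣ ℚ.≤ ε)
    (sym (RationalLemmas.*-recip {seq x n} (RationalLemmas.∣p∣>0⇒p≢0 0<c (h n ≤n)))) (ℚ.<⇒≤ 0<ε)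

√2 : ℝ
√2 = mkℝ sqrt2 sqrt2-cauchy

√2≥0 : 0ℝ ≤ √2
√2≥0 = mk≤ λ ε 0<ε → 0 , λ n _ → RationalLemmas.0≤+ {sqrt2 n} {ε} (0≤sqrt2 n) (ℚ.<⇒≤ 0<ε)

√2*√2≈2 : √2 * √2 ≈ fromℕ 2
√2*√2≈2 = mk≈ λ ε 0<ε →
  let N , h = RationalLemmas.half^-small (¼ ℚ.* ε) (0<¼* 0<ε)
  in N , λ n ≤n → square-close ε n 0<ε (ℚ.≤-trans (RationalLemmas.half^-antimono ≤n) h)

2-√2#0 : fromℕ 2 - √2 # 0ℝ
2-√2#0 = inj₂ (mk< ½ RationalLemmas.0<½ (0 , λ n _ →
  ℚ.+-monoʳ-≤ 2ℚ {ℚ.- (1ℚ ℚ.+ ½)} {ℚ.- sqrt2 n} (ℚ.neg-antimono-≤ (sqrt2≤3/2 n))))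

Matrix : Set → ℕ → ℕ → Set
Matrix A m n = Fin m → Fin n → A

∑ : ∀ {n} → Vector ℝ n → ℝ
∑ = foldr _+_ 0ℝ

infixr 7 _·_ _•_

_·_ : ∀ {m n} → Matrix ℝ m n → Vector ℝ n → Vector ℝ m
(M · x) j = ∑ λ i → M j i * x i

_•_ : ∀ {m n} → ℝ → Matrix ℝ m n → Matrix ℝ m n
(c • M) j i = c * M j i

‖_‖₁ : ∀ {n} → Vector ℝ n → ℝ
‖ x ‖₁ = ∑ λ i → abs (x i)

-- x ≈ 0ℝ is undecidable, so the nonzero coordinates cannot be counted
-- directly; instead they are required to lie in a set of at most k indices.
Sparse : ∀ {n} → ℕ → Vector ℝ n → Set
Sparse {n} k x = ∃[ T ] (∣ T ∣ ℕ.≤ k × (∀ (i : Fin n) → i ∉ T → x i ≈ 0ℝ))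

RIP₁ : ∀ {m n} → ℕ → ℝ → Matrix ℝ m n → Set
RIP₁ k δ M = ∀ x → Sparse k x →
  ‖ x ‖₁ ≤ ‖ M · x ‖₁ × ‖ M · x ‖₁ ≤ (1ℝ + δ) * ‖ x ‖₁

⟦_⟧ : ∀ {n} {P : U.Pred (Fin n) 0ℓ} → U.Decidable P → Subset n
⟦ P? ⟧ = tabulate λ i → does (P? i)

record BipartiteGraph (a b : ℕ) : Set₁ where
  field
    Edge  : REL (Fin a) (Fin b) 0ℓ
    edge? : Decidable Edge

  degree : Fin a → ℕ
  degree i = ∣ ⟦ edge? i ⟧ ∣

  neighbourhood : Subset a → Subset b
  neighbourhood X = ⟦ (λ j → any? λ i → (i ∈? X) ×-dec edge? i j) ⟧

record IsUnbalancedExpander {a b} (G : BipartiteGraph a b) (d k : ℕ) (ε : ℝ) : Set where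
  open BipartiteGraph G
  field
    left-regular : ∀ i → degree i ≡ d
    expands      : ∀ X → ∣ X ∣ ℕ.≤ k →
                   (1ℝ - ε) * fromℕ d * fromℕ ∣ X ∣ ≤ fromℕ ∣ neighbourhood X ∣

-- A matrix with entries in {0,1} is a matrix over Fin 2.
one : Fin 2
one = suc zero

realMatrix : ∀ {m n} → Matrix (Fin 2) m n → Matrix ℝ m n
realMatrix Φ j i = fromℕ (toℕ (Φ j i))

onesInColumn : ∀ {m n} → Matrix (Fin 2) m n → Fin n → ℕ
onesInColumn Φ i = ∣ ⟦ (λ j → Φ j i Fin.≟ one) ⟧ ∣

graph : ∀ {m n} → Matrix (Fin 2) m n → BipartiteGraph n m
graph Φ = record
  { Edge  = λ i j → Φ j i ≡ one
  ; edge? = λ i j → Φ j i Fin.≟ one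
  }

{-# OPTIONS --safe #-}
module Submission where

-- Choose signs for the columns in X greedily so that the signed column sum a
-- satisfies ∑ⱼ aⱼ² ≤ d∣X∣ (parallelogram law).  Every integer a satisfies
-- 3∣a∣ ≤ a² + 2, and aⱼ = 0 for rows j outside N(X), so
-- 3‖a‖₁ ≤ d∣X∣ + 2∣N(X)∣.  The RIP lower bound for this signed indicator vector
-- gives ∣X∣ ≤ S‖a‖₁, and the upper bound for the unsigned one gives S d ≤ 1 + δ;
-- together they yield d∣X∣(1 − (3/2)(1 − 1/(1+δ))) ≤ ∣N(X)∣.  Finally
-- 1/(2 − √2) ≥ 3/2 and δ ≥ 0.

open import Defs using (module RationalLemmas; BipartiteGraph; ⟦_⟧; 2ℚ)
open import Data.Bool.Base using (if_then_else_)
open import Data.Fin.Base using (Fin; zero; suc; toℕ)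
open import Data.Fin.Properties as Fin using (any?)
open import Data.Fin.Subset using (Subset; ∣_∣; _∈_; inside; outside)
open import Data.Fin.Subset.Properties using (_∈?_)
import Data.Integer.Base as ℤ
open import Data.Nat.Base as ℕ using (ℕ; zero; suc)
import Data.Nat.Properties as ℕ
open import Data.Product.Base using (_×_; _,_; ∃-syntax; Σ-syntax; proj₁; proj₂)
open import Data.Rational.Base as ℚ using (ℚ; 0ℚ; 1ℚ; ½)
import Data.Rational.Properties as ℚ
open import Data.Rational.Solver using (module +-*-Solver)
open import Data.Sum.Base using (_⊎_; inj₁; inj₂)
open import Data.Vec.Base using ([]; _∷_)
open import Data.Vec.Functional using (Vector)
open import Level using (0ℓ)
open import Relation.Binary.PropositionalEquality
open import Relation.Nullary.Decidable using (Dec; yes; no; does; _×-dec_; from-yes)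
open import Relation.Nullary.Negation using (¬_; contradiction)
import Relation.Unary as U

-- Finite sums of rationals and counting by indicators.

module RationalSums where
  open import Data.Rational.Base using (_+_; _*_; _≤_)
  open import Algebra.Bundles using (CommutativeRing)
  open import Algebra.Properties.Semiring.Sum (CommutativeRing.semiring ℚ.+-*-commutativeRing) public
  open RationalLemmas

  sum-mono-≤ : ∀ {n} {f g : Vector ℚ n} → (∀ i → f i ≤ g i) → sum f ≤ sum g
  sum-mono-≤ {zero}  f≤g = ℚ.≤-refl
  sum-mono-≤ {suc n} f≤g = ℚ.+-mono-≤ (f≤g zero) (sum-mono-≤ λ i → f≤g (suc i))

  3ℚ : ℚ
  3ℚ = 2ℚ + 1ℚ

  -- Built on `does`, the Boolean that `⟦_⟧` stores, so that cardinalities turn into sums of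
  -- indicators.
  𝟙 : {P : Set} → Dec P → ℚ
  𝟙 P? = if does P? then 1ℚ else 0ℚ

  ∣𝟙∣ : ∀ {P : Set} (P? : Dec P) → ℚ.∣ 𝟙 P? ∣ ≡ 𝟙 P?
  ∣𝟙∣ (yes _) = refl
  ∣𝟙∣ (no _)  = refl

  𝟙-no : ∀ {P : Set} (P? : Dec P) → ¬ P → 𝟙 P? ≡ 0ℚ
  𝟙-no (yes p) ¬p = contradiction p ¬p
  𝟙-no (no _)  ¬p = refl

  𝟙² : ∀ {P : Set} (P? : Dec P) → 𝟙 P? * 𝟙 P? ≡ 𝟙 P?
  𝟙² (yes _) = refl
  𝟙² (no _)  = refl

  𝟙-×-dec : ∀ {P Q : Set} (P? : Dec P) (Q? : Dec Q) → 𝟙 (P? ×-dec Q?) ≡ 𝟙 P? * 𝟙 Q?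
  𝟙-×-dec (yes _) Q? = sym (ℚ.*-identityˡ (𝟙 Q?))
  𝟙-×-dec (no _)  Q? = sym (ℚ.*-zeroˡ (𝟙 Q?))

  ∣p∣≡sum : ∀ {n} (p : Subset n) → ⌜ ∣ p ∣ ⌝ ≡ sum λ i → 𝟙 (i ∈? p)
  ∣p∣≡sum []            = refl
  ∣p∣≡sum (inside  ∷ p) = trans (⌜suc⌝ ∣ p ∣) (cong (1ℚ +_) (∣p∣≡sum p))
  ∣p∣≡sum (outside ∷ p) = trans (∣p∣≡sum p) (sym (ℚ.+-identityˡ (sum λ i → 𝟙 (i ∈? p))))

  ∣⟦P?⟧∣≡sum : ∀ {n} {P : U.Pred (Fin n) 0ℓ} (P? : U.Decidable P) → ⌜ ∣ ⟦ P? ⟧ ∣ ⌝ ≡ sum λ i → 𝟙 (P? i)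
  ∣⟦P?⟧∣≡sum {zero}  P? = refl
  ∣⟦P?⟧∣≡sum {suc n} P? = count (P? zero) (∣⟦P?⟧∣≡sum λ i → P? (suc i))
    where
    rest : Subset n
    rest = ⟦ (λ i → P? (suc i)) ⟧
    -- The head decision is generalised so that matching on it reduces the subset and the indicator
    -- together.
    count : ∀ {Q : Set} (Q? : Dec Q) {t} → ⌜ ∣ rest ∣ ⌝ ≡ t → ⌜ ∣ does Q? ∷ rest ∣ ⌝ ≡ 𝟙 Q? + t
    count (yes _)     eq = trans (⌜suc⌝ ∣ rest ∣) (cong (1ℚ +_) eq)
    count (no _)  {t} eq = trans eq (sym (ℚ.+-identityˡ t))

-- Balancing signs by the parallelogram law.

module Signs where
  open import Data.Rational.Base using (_+_; _*_; _-_; -_; _≤_)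
  open RationalLemmas
  open RationalSums
  open +-*-Solver using (solve; _:=_; _:+_; _:*_; _:-_; :-_; con)
  open ℚ.≤-Reasoning

  sq : ℚ → ℚ
  sq p = p * p

  IsSign : ℚ → Set
  IsSign p = p ≡ 1ℚ ⊎ p ≡ - 1ℚ

  ∣p*sign∣ : ∀ p {s} → IsSign s → ℚ.∣ p * s ∣ ≡ ℚ.∣ p ∣
  ∣p*sign∣ p {s} h = trans (ℚ.∣p*q∣≡∣p∣*∣q∣ p s)
    (trans (cong (ℚ.∣ p ∣ *_) (∣s∣ h)) (ℚ.*-identityʳ ℚ.∣ p ∣))
    where
    ∣s∣ : ∀ {s} → IsSign s → ℚ.∣ s ∣ ≡ 1ℚ
    ∣s∣ (inj₁ refl) = refl
    ∣s∣ (inj₂ refl) = refl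

  -- Averaging: two numbers with mean `r` cannot both exceed `r`. The order on ℚ is decidable, so
  -- the smaller one can be selected constructively.
  p+q≡r+r⇒p≤r⊎q≤r : ∀ {p q r} → p + q ≡ r + r → p ≤ r ⊎ q ≤ r
  p+q≡r+r⇒p≤r⊎q≤r {p} {q} {r} eq with p ℚ.≤? r | q ℚ.≤? r
  ... | yes p≤r | _       = inj₁ p≤r
  ... | no _    | yes q≤r = inj₂ q≤r
  ... | no p≰r  | no q≰r  =
    contradiction (sym eq) (ℚ.<⇒≢ (ℚ.+-mono-< (ℚ.≰⇒> p≰r) (ℚ.≰⇒> q≰r)))

  -- The signs stay as factors `1ℚ` and `- 1ℚ` so that each sum on the left is literally the squared
  -- norm after adding one more signed vector.
  parallelogram : ∀ {m} (a b : Vector ℚ m) →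
    sum (λ j → sq (a j * 1ℚ + b j)) + sum (λ j → sq (a j * - 1ℚ + b j)) ≡
    (sum (λ j → sq (a j)) + sum (λ j → sq (b j))) + (sum (λ j → sq (a j)) + sum (λ j → sq (b j)))
  parallelogram a b = begin-equality
    sum (λ j → sq (a j * 1ℚ + b j)) + sum (λ j → sq (a j * - 1ℚ + b j))
      ≡⟨ ∑-distrib-+ (λ j → sq (a j * 1ℚ + b j)) (λ j → sq (a j * - 1ℚ + b j)) ⟨
    sum (λ j → sq (a j * 1ℚ + b j) + sq (a j * - 1ℚ + b j))
      ≡⟨ sum-cong-≗ (λ j → solve 2 (λ x y →
           (x :* con 1ℚ :+ y) :* (x :* con 1ℚ :+ y) :+ (x :* con (- 1ℚ) :+ y) :* (x :* con (- 1ℚ) :+ y)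
           := (x :* x :+ y :* y) :+ (x :* x :+ y :* y)) refl (a j) (b j)) ⟩
    sum (λ j → (a² j + b² j) + (a² j + b² j))
      ≡⟨ ∑-distrib-+ (λ j → a² j + b² j) (λ j → a² j + b² j) ⟩
    sum (λ j → a² j + b² j) + sum (λ j → a² j + b² j)
      ≡⟨ cong (λ t → t + t) (∑-distrib-+ a² b²) ⟩
    (sum a² + sum b²) + (sum a² + sum b²) ∎
    where
    a² b² : Vector ℚ _
    a² j = sq (a j)
    b² j = sq (b j)

  -- The right-hand side is the expected squared norm of the signed sum under independent uniform
  -- signs; a balanced `σ` does at least as well as this average.
  Balanced : ∀ {m n} → (Fin n → Vector ℚ m) → Set
  Balanced {n = n} w = Σ[ σ ∈ Vector ℚ n ] ((∀ i → IsSign (σ i)) ×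
    sum (λ j → sq (sum λ i → w i j * σ i)) ≤ sum (λ i → sum λ j → sq (w i j)))

  -- By the parallelogram law, one of the two choices for each further sign
  -- raises the squared norm by at most that of the new vector.
  balanced-signs : ∀ {m n} (w : Fin n → Vector ℚ m) → Balanced w
  balanced-signs {m} {zero}  w = (λ ()) , (λ ()) , ℚ.≤-reflexive (sum-replicate-zero m)
  balanced-signs {m} {suc n} w = step (balanced-signs λ i → w (suc i))
    where
    step : Balanced (λ i → w (suc i)) → Balanced w
    step (σ , signs , h) = choose (p+q≡r+r⇒p≤r⊎q≤r
      {sum λ j → sq (w zero j * 1ℚ + rest j)} {sum λ j → sq (w zero j * - 1ℚ + rest j)} {bound}
      (parallelogram (w zero) rest))
      where
      rest : Vector ℚ m
      rest j = sum λ i → w (suc i) j * σ i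

      bound : ℚ
      bound = sum (λ j → sq (w zero j)) + sum (λ j → sq (rest j))

      extend : ∀ s → IsSign s → sum (λ j → sq (w zero j * s + rest j)) ≤ bound → Balanced w
      extend s sign le = (λ { zero → s ; (suc i) → σ i })
        , (λ { zero → sign ; (suc i) → signs i })
        , ℚ.≤-trans le (ℚ.+-monoʳ-≤ (sum λ j → sq (w zero j)) h)

      choose : sum (λ j → sq (w zero j * 1ℚ + rest j)) ≤ bound
             ⊎ sum (λ j → sq (w zero j * - 1ℚ + rest j)) ≤ bound → Balanced w
      choose (inj₁ le) = extend 1ℚ (inj₁ refl) le
      choose (inj₂ le) = extend (- 1ℚ) (inj₂ refl) le

  -- Integrality of signed sums and the inequality for integers.

  IsInteger : ℚ → Set
  IsInteger p = ∃[ n ] (p ≡ ⌜ n ⌝ ⊎ p ≡ - ⌜ n ⌝)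

  integer-neg : ∀ {p} → IsInteger p → IsInteger (- p)
  integer-neg     (n , inj₁ refl) = n , inj₂ refl
  integer-neg     (n , inj₂ refl) = n , inj₁ (solve 1 (λ t → :- :- t := t) refl ⌜ n ⌝)

  integer-1+ : ∀ {p} → IsInteger p → IsInteger (1ℚ + p)
  integer-1+ (n , inj₁ refl)     = suc n , inj₁ (sym (⌜suc⌝ n))
  -- Minus zero has no predecessor to step down to, so the result is the positive 1.
  integer-1+ (zero , inj₂ refl)  = 1 , inj₁ refl
  integer-1+ (suc n , inj₂ refl) = n , inj₂ (trans (cong (λ t → 1ℚ - t) (⌜suc⌝ n))
    (solve 1 (λ t → con 1ℚ :- (con 1ℚ :+ t) := :- t) refl ⌜ n ⌝))

  -- Adding -1 is adding 1 between two negations, so only `integer-1+` is required.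
  integer-sign+ : ∀ {s p} → IsSign s → IsInteger p → IsInteger (s + p)
  integer-sign+     (inj₁ refl) h = integer-1+ h
  integer-sign+ {p = p} (inj₂ refl) h = subst IsInteger
    (solve 1 (λ t → :- (con 1ℚ :+ :- t) := con (- 1ℚ) :+ t) refl p)
    (integer-neg (integer-1+ (integer-neg h)))

  integer-signed-sum : ∀ {n} {P : U.Pred (Fin n) 0ℓ} (P? : U.Decidable P) {σ : Vector ℚ n} → (∀ i → IsSign (σ i)) →
    IsInteger (sum λ i → 𝟙 (P? i) * σ i)
  integer-signed-sum {zero}  P? signs = 0 , inj₁ refl
  integer-signed-sum {suc n} P? {σ} signs =
    add (P? zero) (integer-signed-sum (λ i → P? (suc i)) (λ i → signs (suc i)))
    where
    add : ∀ {P : Set} (P? : Dec P) {t} → IsInteger t → IsInteger (𝟙 P? * σ zero + t)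
    add (yes _) {t} h = subst (λ s → IsInteger (s + t)) (sym (ℚ.*-identityˡ (σ zero)))
      (integer-sign+ (signs zero) h)
    add (no _)  {t} h = subst IsInteger
      (sym (trans (cong (_+ t) (ℚ.*-zeroˡ (σ zero))) (ℚ.+-identityˡ t))) h

  -- (n − 1)(n − 2) ≥ 0 for every natural number n.
  3n≤n²+2 : ∀ n → 3ℚ * ⌜ n ⌝ ≤ sq ⌜ n ⌝ + 2ℚ
  3n≤n²+2 zero          = from-yes (3ℚ * 0ℚ ℚ.≤? 0ℚ * 0ℚ + 2ℚ)
  3n≤n²+2 (suc zero)    = from-yes (3ℚ * 1ℚ ℚ.≤? 1ℚ * 1ℚ + 2ℚ)
  3n≤n²+2 (suc (suc n)) = begin
    3ℚ * ⌜ 2 ℕ.+ n ⌝                  ≡⟨ cong (3ℚ *_) eq ⟩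
    3ℚ * (2ℚ + t)                     ≡⟨ ℚ.+-identityʳ (3ℚ * (2ℚ + t)) ⟨
    3ℚ * (2ℚ + t) + 0ℚ                ≤⟨ ℚ.+-monoʳ-≤ (3ℚ * (2ℚ + t)) (0≤+ 0≤t² (0≤⌜⌝ n)) ⟩
    3ℚ * (2ℚ + t) + (t * t + t)       ≡⟨ solve 1 (λ t → con 3ℚ :* (con 2ℚ :+ t) :+ (t :* t :+ t)
                                          := (con 2ℚ :+ t) :* (con 2ℚ :+ t) :+ con 2ℚ) refl t ⟩
    sq (2ℚ + t) + 2ℚ                  ≡⟨ cong (λ s → sq s + 2ℚ) eq ⟨
    sq ⌜ 2 ℕ.+ n ⌝ + 2ℚ               ∎
    where
    t : ℚ
    t = ⌜ n ⌝
    0≤t² : 0ℚ ≤ t * t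
    0≤t² = subst (_≤ t * t) (ℚ.*-zeroʳ t) (*-monoˡ t (0≤⌜⌝ n) (0≤⌜⌝ n))
    eq : ⌜ 2 ℕ.+ n ⌝ ≡ 2ℚ + t
    eq = trans (⌜suc⌝ (suc n)) (trans (cong (1ℚ +_) (⌜suc⌝ n)) (sym (ℚ.+-assoc 1ℚ 1ℚ t)))

  -- Both sides are even in `p`, so the case of naturals decides. Equality holds at absolute values
  -- 1 and 2.
  3∣p∣≤p²+2 : ∀ {p} → IsInteger p → 3ℚ * ℚ.∣ p ∣ ≤ sq p + 2ℚ
  3∣p∣≤p²+2 (n , inj₁ refl) = subst (λ t → 3ℚ * t ≤ sq ⌜ n ⌝ + 2ℚ) (sym (ℚ.0≤p⇒∣p∣≡p (0≤⌜⌝ n))) (3n≤n²+2 n)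
  3∣p∣≤p²+2 (n , inj₂ refl) = subst₂ (λ t u → 3ℚ * t ≤ u + 2ℚ)
    (sym (trans (ℚ.∣-p∣≡∣p∣ ⌜ n ⌝) (ℚ.0≤p⇒∣p∣≡p (0≤⌜⌝ n))))
    (solve 1 (λ t → t :* t := :- t :* :- t) refl ⌜ n ⌝) (3n≤n²+2 n)

-- Signed edge counts between X and its neighbourhood.

module SignedNeighbourhoods {a b} (G : BipartiteGraph a b) (X : Subset a) where
  open import Data.Rational.Base using (_+_; _*_; _≤_)
  open BipartiteGraph G
  open RationalLemmas
  open RationalSums
  open Signs
  open ℚ.≤-Reasoning

  -- Columns outside `X` are set to zero, so sums over `X` can run over all of `Fin a` and signs
  -- outside `X` have no effect.
  incidence : Fin a → Vector ℚ b
  incidence i j = 𝟙 ((i ∈? X) ×-dec edge? i j)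

  signedDegree : Vector ℚ a → Vector ℚ b
  signedDegree σ j = sum λ i → incidence i j * σ i

  -- Counts the edges leaving `X` by their left endpoints, each of degree d.
  sum-incidence : ∀ {d} → (∀ i → degree i ≡ d) → (sum λ i → sum λ j → incidence i j) ≡ ⌜ d ⌝ * ⌜ ∣ X ∣ ⌝
  sum-incidence {d} regular = begin-equality
    (sum λ i → sum λ j → incidence i j)
      ≡⟨ (sum-cong-≗ λ i → sum-cong-≗ λ j → 𝟙-×-dec (i ∈? X) (edge? i j)) ⟩
    (sum λ i → sum λ j → 𝟙 (i ∈? X) * 𝟙 (edge? i j))
      ≡⟨ (sum-cong-≗ λ i → *-distribˡ-sum (𝟙 (i ∈? X)) (λ j → 𝟙 (edge? i j))) ⟨
    (sum λ i → 𝟙 (i ∈? X) * sum λ j → 𝟙 (edge? i j))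
      ≡⟨ (sum-cong-≗ λ i → trans (cong (𝟙 (i ∈? X) *_)
           (trans (sym (∣⟦P?⟧∣≡sum (edge? i))) (cong ⌜_⌝ (regular i)))) (ℚ.*-comm (𝟙 (i ∈? X)) ⌜ d ⌝)) ⟩
    (sum λ i → ⌜ d ⌝ * 𝟙 (i ∈? X))
      ≡⟨ *-distribˡ-sum ⌜ d ⌝ (λ i → 𝟙 (i ∈? X)) ⟨
    ⌜ d ⌝ * (sum λ i → 𝟙 (i ∈? X))
      ≡⟨ cong (⌜ d ⌝ *_) (∣p∣≡sum X) ⟨
    ⌜ d ⌝ * ⌜ ∣ X ∣ ⌝ ∎

  -- The same decision procedure as in `neighbourhood`, so its indicators sum to the size of N(X).
  isNeighbour? : ∀ j → Dec (∃[ i ] (i ∈ X × Edge i j))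
  isNeighbour? j = any? λ i → (i ∈? X) ×-dec edge? i j

  signedDegree-outside : ∀ σ j → ¬ (∃[ i ] (i ∈ X × Edge i j)) → signedDegree σ j ≡ 0ℚ
  signedDegree-outside σ j ¬h = trans (sum-cong-≗ zero-entry) (sum-replicate-zero a)
    where
    zero-entry : ∀ i → incidence i j * σ i ≡ 0ℚ
    zero-entry i = trans (cong (_* σ i) (𝟙-no ((i ∈? X) ×-dec edge? i j) λ h → ¬h (i , h))) (ℚ.*-zeroˡ (σ i))

  -- The additive 2 of the integer inequality is charged to neighbours only: at any other vertex the
  -- signed degree is 0 and both sides vanish.
  3∣signedDegree∣≤ : ∀ {σ : Vector ℚ a} → (∀ i → IsSign (σ i)) → ∀ j →
    3ℚ * ℚ.∣ signedDegree σ j ∣ ≤ sq (signedDegree σ j) + 2ℚ * 𝟙 (isNeighbour? j)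
  3∣signedDegree∣≤ {σ} signs j = go (isNeighbour? j)
    where
    go : (N? : Dec _) → 3ℚ * ℚ.∣ signedDegree σ j ∣ ≤ sq (signedDegree σ j) + 2ℚ * 𝟙 N?
    go (yes _) = subst (λ t → 3ℚ * ℚ.∣ signedDegree σ j ∣ ≤ sq (signedDegree σ j) + t)
      (sym (ℚ.*-identityʳ 2ℚ))
      (3∣p∣≤p²+2 (integer-signed-sum (λ i → (i ∈? X) ×-dec edge? i j) signs))
    go (no ¬h) = subst (λ t → 3ℚ * ℚ.∣ t ∣ ≤ sq t + 2ℚ * 0ℚ) (sym (signedDegree-outside σ j ¬h))
      (from-yes (3ℚ * ℚ.∣ 0ℚ ∣ ℚ.≤? sq 0ℚ + 2ℚ * 0ℚ))

  balanced : ∀ {d} → (∀ i → degree i ≡ d) →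
    Σ[ σ ∈ Vector ℚ a ] ((∀ i → IsSign (σ i)) ×
      3ℚ * sum (λ j → ℚ.∣ signedDegree σ j ∣) ≤ ⌜ d ⌝ * ⌜ ∣ X ∣ ⌝ + 2ℚ * ⌜ ∣ neighbourhood X ∣ ⌝)
  balanced {d} regular = let σ , signs , h = balanced-signs incidence in σ , signs , 3L≤ σ signs h
    where
    N : Vector ℚ b
    N j = 𝟙 (isNeighbour? j)
    M : ℚ
    M = 2ℚ * ⌜ ∣ neighbourhood X ∣ ⌝
    3L≤ : ∀ σ → (∀ i → IsSign (σ i)) →
          sum (λ j → sq (signedDegree σ j)) ≤ sum (λ i → sum λ j → sq (incidence i j)) →
          3ℚ * sum (λ j → ℚ.∣ signedDegree σ j ∣) ≤ ⌜ d ⌝ * ⌜ ∣ X ∣ ⌝ + M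
    3L≤ σ signs h = begin
      3ℚ * sum (λ j → ℚ.∣ signedDegree σ j ∣)
        ≡⟨ *-distribˡ-sum 3ℚ (λ j → ℚ.∣ signedDegree σ j ∣) ⟩
      sum (λ j → 3ℚ * ℚ.∣ signedDegree σ j ∣)
        ≤⟨ sum-mono-≤ (3∣signedDegree∣≤ signs) ⟩
      sum (λ j → sq (signedDegree σ j) + 2ℚ * N j)
        ≡⟨ ∑-distrib-+ (λ j → sq (signedDegree σ j)) (λ j → 2ℚ * N j) ⟩
      sum (λ j → sq (signedDegree σ j)) + sum (λ j → 2ℚ * N j)
        ≡⟨ cong (sum (λ j → sq (signedDegree σ j)) +_) (*-distribˡ-sum 2ℚ N) ⟨
      sum (λ j → sq (signedDegree σ j)) + 2ℚ * sum N
        ≡⟨ cong (λ t → sum (λ j → sq (signedDegree σ j)) + 2ℚ * t) (∣⟦P?⟧∣≡sum isNeighbour?) ⟨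
      sum (λ j → sq (signedDegree σ j)) + M
        ≤⟨ ℚ.+-monoˡ-≤ M h ⟩
      sum (λ i → sum λ j → sq (incidence i j)) + M
        -- A 0/1 entry equals its square, so the sum of squared column norms is the number of edges
        -- leaving `X`.
        ≡⟨ cong (_+ M) (sum-cong-≗ λ i → sum-cong-≗ λ j → 𝟙² ((i ∈? X) ×-dec edge? i j)) ⟩
      sum (λ i → sum λ j → incidence i j) + M
        ≡⟨ cong (_+ M) (sum-incidence regular) ⟩
      ⌜ d ⌝ * ⌜ ∣ X ∣ ⌝ + M ∎

  -- With all signs +1 nothing cancels, so the 1-norm is the edge count, obtained by exchanging the
  -- two sums.
  sum-signedDegree-1 : ∀ {d} → (∀ i → degree i ≡ d) →
    (sum λ j → ℚ.∣ signedDegree (λ _ → 1ℚ) j ∣) ≡ ⌜ d ⌝ * ⌜ ∣ X ∣ ⌝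
  sum-signedDegree-1 {d} regular = trans (sum-cong-≗ λ j → trans (ℚ.0≤p⇒∣p∣≡p (0≤row j)) (row j))
    (trans (∑-comm (λ j i → incidence i j)) (sum-incidence regular))
    where
    row : ∀ j → signedDegree (λ _ → 1ℚ) j ≡ sum λ i → incidence i j
    row j = sum-cong-≗ λ i → ℚ.*-identityʳ (incidence i j)
    0≤𝟙 : ∀ {P : Set} (P? : Dec P) → 0ℚ ≤ 𝟙 P?
    0≤𝟙 (yes _) = ℚ.<⇒≤ 0<1
    0≤𝟙 (no _)  = ℚ.≤-refl
    0≤row : ∀ j → 0ℚ ≤ signedDegree (λ _ → 1ℚ) j
    0≤row j = subst₂ _≤_ (sum-replicate-zero a) (sym (row j))
      (sum-mono-≤ λ i → 0≤𝟙 ((i ∈? X) ×-dec edge? i j))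

open import Defs

-- Order and monotonicity for Cauchy reals.

module RealOrder where
  import Relation.Binary.Reasoning.Base.Single as Reasoning
  open RationalLemmas using (0<*; 0<recip; 0<⇒≢0)

  ∀≤⇒≤ : ∀ x y → (∀ n → seq x n ℚ.≤ seq y n) → x ≤ y
  ∀≤⇒≤ x y h = mk≤ λ ε 0<ε → 0 , λ n _ →
    subst (ℚ._≤ seq y n ℚ.+ ε) (ℚ.+-identityʳ (seq x n)) (ℚ.+-mono-≤ (h n) (ℚ.<⇒≤ 0<ε))

  ∀≡⇒≤ : ∀ x y → (∀ n → seq x n ≡ seq y n) → x ≤ y
  ∀≡⇒≤ x y h = ∀≤⇒≤ x y λ n → ℚ.≤-reflexive (h n)

  ≤-refl : ∀ {x} → x ≤ x
  ≤-refl {x} = ∀≡⇒≤ x x λ _ → refl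

  ≤-trans : ∀ {x y z} → x ≤ y → y ≤ z → x ≤ z
  ≤-trans {x} {y} {z} (mk≤ xy) (mk≤ yz) = mk≤ λ ε 0<ε →
    let 0<½ε = 0<* RationalLemmas.0<½ 0<ε
        M , hM = xy (½ ℚ.* ε) 0<½ε
        N , hN = yz (½ ℚ.* ε) 0<½ε
    in M ℕ.⊔ N , λ n ≤n → begin
      seq x n                             ≤⟨ hM n (ℕ.m⊔n≤o⇒m≤o M N ≤n) ⟩
      seq y n ℚ.+ ½ ℚ.* ε                 ≤⟨ ℚ.+-monoˡ-≤ (½ ℚ.* ε) (hN n (ℕ.m⊔n≤o⇒n≤o M N ≤n)) ⟩
      seq z n ℚ.+ ½ ℚ.* ε ℚ.+ ½ ℚ.* ε     ≡⟨ ℚ.+-assoc (seq z n) (½ ℚ.* ε) (½ ℚ.* ε) ⟩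
      seq z n ℚ.+ (½ ℚ.* ε ℚ.+ ½ ℚ.* ε)   ≡⟨ cong (seq z n ℚ.+_) (RationalLemmas.½*p+½*p≡p ε) ⟩
      seq z n ℚ.+ ε                       ∎
    where open ℚ.≤-Reasoning

  module ≤-Reasoning = Reasoning _≤_ ≤-refl ≤-trans

  +-mono-≤ : ∀ {x y z w} → x ≤ y → z ≤ w → x + z ≤ y + w
  +-mono-≤ {x} {y} {z} {w} (mk≤ xy) (mk≤ zw) = mk≤ λ ε 0<ε →
    let 0<½ε = 0<* RationalLemmas.0<½ 0<ε
        M , hM = xy (½ ℚ.* ε) 0<½ε
        N , hN = zw (½ ℚ.* ε) 0<½ε
    in M ℕ.⊔ N , λ n ≤n → begin
      seq x n ℚ.+ seq z n
        ≤⟨ ℚ.+-mono-≤ (hM n (ℕ.m⊔n≤o⇒m≤o M N ≤n)) (hN n (ℕ.m⊔n≤o⇒n≤o M N ≤n)) ⟩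
      (seq y n ℚ.+ ½ ℚ.* ε) ℚ.+ (seq w n ℚ.+ ½ ℚ.* ε)
        ≡⟨ solve 3 (λ a b e → (a :+ con ½ :* e) :+ (b :+ con ½ :* e) := (a :+ b) :+ e) refl
             (seq y n) (seq w n) ε ⟩
      (seq y n ℚ.+ seq w n) ℚ.+ ε ∎
    where
    open ℚ.≤-Reasoning
    open +-*-Solver using (solve; _:=_; _:+_; _:*_; con)

  -- Stronger than `0ℝ ≤ x`, which lets terms be slightly negative; a definite sign allows termwise
  -- multiplication of inequalities.
  EventuallyNonNegative : ℝ → Set
  EventuallyNonNegative x = Eventually λ n → 0ℚ ℚ.≤ seq x n

  *-monoˡ-≤ : ∀ c → EventuallyNonNegative c → ∀ {x y} → x ≤ y → c * x ≤ c * y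
  *-monoˡ-≤ c (K , 0≤c) {x} {y} (mk≤ xy) = mk≤ λ ε 0<ε →
    let B , 0<B , L , hB = CauchyLemmas.bound (seq c) (cauchy c)
        -- Since `c` is eventually at most `B`, an error `η` in the factor costs at most `ε` in the
        -- product.
        η   = RationalLemmas.recip B ℚ.* ε
        0<η = 0<* (0<recip 0<B) 0<ε
        M , hM = xy η 0<η
    in K ℕ.⊔ (L ℕ.⊔ M) , λ n ≤n →
      let 0≤cₙ = 0≤c n (ℕ.m⊔n≤o⇒m≤o K (L ℕ.⊔ M) ≤n)
          LM≤n = ℕ.m⊔n≤o⇒n≤o K (L ℕ.⊔ M) ≤n
          cₙ≤B = subst (ℚ._≤ B) (ℚ.0≤p⇒∣p∣≡p 0≤cₙ) (hB n (ℕ.m⊔n≤o⇒m≤o L M LM≤n))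
      in begin
        seq c n ℚ.* seq x n
          ≤⟨ RationalLemmas.*-monoˡ (seq c n) 0≤cₙ (hM n (ℕ.m⊔n≤o⇒n≤o L M LM≤n)) ⟩
        seq c n ℚ.* (seq y n ℚ.+ η)
          ≡⟨ ℚ.*-distribˡ-+ (seq c n) (seq y n) η ⟩
        seq c n ℚ.* seq y n ℚ.+ seq c n ℚ.* η
          ≤⟨ ℚ.+-monoʳ-≤ (seq c n ℚ.* seq y n)
               (CauchyLemmas.prod≤ 0<B 0≤cₙ 0<ε cₙ≤B ℚ.≤-refl) ⟩
        seq c n ℚ.* seq y n ℚ.+ ε ∎
    where open ℚ.≤-Reasoning

  ≈⇒≤ : ∀ {x y} → x ≈ y → x ≤ y
  ≈⇒≤ {x} {y} (mk≈ xy) = mk≤ λ ε 0<ε → let N , h = xy ε 0<ε in N , λ n ≤n → begin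
    seq x n                         ≡⟨ solve 2 (λ a b → a := b :+ (a :- b)) refl (seq x n) (seq y n) ⟩
    seq y n ℚ.+ (seq x n ℚ.- seq y n)
      ≤⟨ ℚ.+-monoʳ-≤ (seq y n) (ℚ.≤-trans (RationalLemmas.p≤∣p∣ (seq x n ℚ.- seq y n)) (h n ≤n)) ⟩
    seq y n ℚ.+ ε                   ∎
    where
    open ℚ.≤-Reasoning
    open +-*-Solver using (solve; _:=_; _:+_; _:-_)

  -- Tolerance ½ in `1ℝ ≤ x` keeps the terms of `x` eventually at least ½, hence their reciprocals
  -- positive.
  ⁻¹-nonNegative : ∀ {x} (x#0 : x # 0ℝ) → 1ℝ ≤ x → EventuallyNonNegative (x ⁻¹[ x#0 ])
  ⁻¹-nonNegative {x} x#0 (mk≤ 1≤x) = let N , h = 1≤x ½ RationalLemmas.0<½ in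
    N , λ n ≤n → ℚ.<⇒≤ (0<recip (ℚ.<-≤-trans RationalLemmas.0<½
      (subst (½ ℚ.≤_) (cancel (seq x n)) (ℚ.+-monoˡ-≤ (ℚ.- ½) (h n ≤n)))))
    where
    open +-*-Solver using (solve; _:=_; _:+_; :-_; con)
    cancel : ∀ t → (t ℚ.+ ½) ℚ.+ ℚ.- ½ ≡ t
    cancel = solve 1 (λ t → (t :+ con ½) :+ :- con ½ := t) refl

-- The final estimate, including 1/(2 - √2) ≥ 3/2.

module ExpansionBound where
  open RationalLemmas using (recip; half^; *-recip; 0<*; 0<recip; 0<⇒≢0)
  open RationalSums using (3ℚ)
  open Sqrt2Lemmas
  open RealOrder
  open +-*-Solver using (solve; _:=_; _:+_; _:*_; :-_; con)

  -- 4/3 is a lower bound for √2, so 2 - √2 is at most 2/3, the reciprocal of 3/2; 1/16 is the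
  -- bisection error `half^ 4`.
  3/2 4/3 2/3 1/16 : ℚ
  3/2  = ℤ.+ 3 ℚ./ 2
  4/3  = ℤ.+ 4 ℚ./ 3
  2/3  = ℤ.+ 2 ℚ./ 3
  1/16 = ℤ.+ 1 ℚ./ 16

  -- The square of 4/3 + 1/16 is still below 2, while that of `sqrt2 n + half^ n` exceeds 2; from
  -- index 4 on `half^ n` is at most 1/16.
  sqrt2≥4/3 : ∀ n → 4 ℕ.≤ n → 4/3 ℚ.≤ sqrt2 n
  sqrt2≥4/3 n 4≤n = begin
    4/3                           ≡⟨⟩
    (4/3 ℚ.+ 1/16) ℚ.- 1/16       ≤⟨ RationalLemmas.p≤q+r⇒p-q≤r 1/16 {sqrt2 n} (begin
      4/3 ℚ.+ 1/16                  <⟨ RationalLemmas.p*p<q*q⇒p<q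
                                        (RationalLemmas.0≤+ {sqrt2 n} (0≤sqrt2 n) (ℚ.<⇒≤ (RationalLemmas.0<half^ n)))
                                        (ℚ.<-trans (from-yes ((4/3 ℚ.+ 1/16) ℚ.* (4/3 ℚ.+ 1/16) ℚ.<? 2ℚ)) (upper n)) ⟩
      sqrt2 n ℚ.+ half^ n           ≤⟨ ℚ.+-monoʳ-≤ (sqrt2 n) (RationalLemmas.half^-antimono 4≤n) ⟩
      sqrt2 n ℚ.+ 1/16              ≡⟨ ℚ.+-comm (sqrt2 n) 1/16 ⟩
      1/16 ℚ.+ sqrt2 n              ∎) ⟩
    sqrt2 n                       ∎
    where open ℚ.≤-Reasoning

  3/2≤recip : ∀ {p} → 0ℚ ℚ.< p → p ℚ.≤ 2/3 → 3/2 ℚ.≤ recip p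
  3/2≤recip {p} 0<p p≤ = begin
    3/2                       ≡⟨ cong (3/2 ℚ.*_) (*-recip (0<⇒≢0 0<p)) ⟨
    3/2 ℚ.* (p ℚ.* recip p)   ≤⟨ RationalLemmas.*-monoˡ 3/2 (from-yes (0ℚ ℚ.≤? 3/2))
                                   (RationalLemmas.*-monoʳ (recip p) (ℚ.<⇒≤ (0<recip 0<p)) p≤) ⟩
    3/2 ℚ.* (2/3 ℚ.* recip p) ≡⟨ solve 1 (λ t → con 3/2 :* (con 2/3 :* t) := t) refl (recip p) ⟩
    recip p                   ∎
    where open ℚ.≤-Reasoning

  v : ℝ
  v = (fromℕ 2 - √2) ⁻¹[ 2-√2#0 ]

  3/2≤v : Eventually λ n → 3/2 ℚ.≤ seq v n
  3/2≤v = 4 , λ n 4≤n → 3/2≤recip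
    -- The bound √2 ≤ 3/2 gives positivity of 2 - √2; √2 ≥ 4/3 then bounds it by 2/3.
    (ℚ.<-≤-trans RationalLemmas.0<½ (ℚ.+-monoʳ-≤ 2ℚ {ℚ.- (1ℚ ℚ.+ ½)} (ℚ.neg-antimono-≤ (sqrt2≤3/2 n))))
    (ℚ.+-monoʳ-≤ 2ℚ {_} {ℚ.- 4/3} (ℚ.neg-antimono-≤ (sqrt2≥4/3 n 4≤n)))

  always : ∀ {x} → (∀ n → 0ℚ ℚ.≤ seq x n) → EventuallyNonNegative x
  always h = 0 , λ n _ → h n

  nonNeg* : ∀ {p q} → 0ℚ ℚ.≤ p → 0ℚ ℚ.≤ q → 0ℚ ℚ.≤ p ℚ.* q
  nonNeg* {p} {q} 0≤p 0≤q = subst (ℚ._≤ p ℚ.* q) (ℚ.*-zeroʳ p) (RationalLemmas.*-monoˡ p 0≤p 0≤q)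

  -- Here `D` is d, `K` is ∣X∣, `N` is ∣N(X)∣, `L` is the 1-norm of the balanced signed column sum,
  -- `T` is ∣S∣ and `w` is 1 + δ. The last three hypotheses are the RIP lower bound for balanced
  -- signs and both RIP bounds for signs all +1.
  module _ (D K N L : ℚ) (0≤D : 0ℚ ℚ.≤ D) (0<K : 0ℚ ℚ.< K) (0≤N : 0ℚ ℚ.≤ N)
           (3L≤ : 3ℚ ℚ.* L ℚ.≤ D ℚ.* K ℚ.+ 2ℚ ℚ.* N)
           (T w : ℝ) (w#0 : w # 0ℝ) (0≤T : ∀ n → 0ℚ ℚ.≤ seq T n)
           (K≤TL : fromℚ K ≤ T * fromℚ L)
           (K≤TDK : fromℚ K ≤ T * fromℚ (D ℚ.* K))
           (TDK≤wK : T * fromℚ (D ℚ.* K) ≤ w * fromℚ K) where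
    open ≤-Reasoning

    u : ℝ
    u = w ⁻¹[ w#0 ]

    κ : ℚ
    κ = recip K

    M : ℚ
    M = D ℚ.* K ℚ.+ 2ℚ ℚ.* N

    DK : ℚ
    DK = D ℚ.* K

    0≤κ : EventuallyNonNegative (fromℚ κ)
    0≤κ = always {fromℚ κ} λ _ → ℚ.<⇒≤ (0<recip 0<K)

    K*κ : K ℚ.* κ ≡ 1ℚ
    K*κ = *-recip (0<⇒≢0 0<K)

    cancel-K : ∀ t → κ ℚ.* (t ℚ.* K) ≡ t
    cancel-K t = trans (solve 3 (λ k t K → k :* (t :* K) := (K :* k) :* t) refl κ t K)
      (trans (cong (ℚ._* t) K*κ) (ℚ.*-identityˡ t))

    cancel-DK : ∀ t → κ ℚ.* (t ℚ.* DK) ≡ t ℚ.* D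
    cancel-DK t = trans (cong (κ ℚ.*_) (sym (ℚ.*-assoc t D K))) (cancel-K (t ℚ.* D))

    TD≤w : T * fromℚ D ≤ w
    TD≤w = begin
      T * fromℚ D               ∼⟨ ∀≡⇒≤ _ _ (λ n → sym (cancel-DK (seq T n))) ⟩
      fromℚ κ * (T * fromℚ DK)  ∼⟨ *-monoˡ-≤ (fromℚ κ) 0≤κ TDK≤wK ⟩
      fromℚ κ * (w * fromℚ K)   ∼⟨ ∀≡⇒≤ _ _ (λ n → cancel-K (seq w n)) ⟩
      w                         ∎

    -- This is δ ≥ 0: the two bounds for the unsigned indicator squeeze `T * fromℚ D` between 1 and
    -- `w`.
    1≤w : 1ℝ ≤ w
    1≤w = begin
      1ℝ                        ∼⟨ ∀≡⇒≤ _ _ (λ _ → trans (sym K*κ) (ℚ.*-comm K κ)) ⟩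
      fromℚ κ * fromℚ K         ∼⟨ *-monoˡ-≤ (fromℚ κ) 0≤κ K≤TDK ⟩
      fromℚ κ * (T * fromℚ DK)  ∼⟨ ∀≡⇒≤ _ _ (λ n → cancel-DK (seq T n)) ⟩
      T * fromℚ D               ∼⟨ TD≤w ⟩
      w                         ∎

    0≤u : EventuallyNonNegative u
    0≤u = ⁻¹-nonNegative w#0 1≤w

    uw≤1 : u * w ≤ 1ℝ
    uw≤1 = begin
      u * w   ∼⟨ ∀≡⇒≤ _ _ (λ n → ℚ.*-comm (seq u n) (seq w n)) ⟩
      w * u   ∼⟨ ≈⇒≤ (*-inverseʳ w w#0) ⟩
      1ℝ      ∎

    u≤1 : u ≤ 1ℝ
    u≤1 = begin
      u        ∼⟨ ∀≡⇒≤ _ _ (λ n → sym (ℚ.*-identityʳ (seq u n))) ⟩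
      u * 1ℝ   ∼⟨ *-monoˡ-≤ u 0≤u 1≤w ⟩
      u * w    ∼⟨ uw≤1 ⟩
      1ℝ       ∎

    uTD≤1 : u * (T * fromℚ D) ≤ 1ℝ
    uTD≤1 = ≤-trans (*-monoˡ-≤ u 0≤u TD≤w) uw≤1

    3K≤TM : fromℚ 3ℚ * fromℚ K ≤ T * fromℚ M
    3K≤TM = begin
      fromℚ 3ℚ * fromℚ K          ∼⟨ *-monoˡ-≤ (fromℚ 3ℚ) (always {fromℚ 3ℚ} λ _ → from-yes (0ℚ ℚ.≤? 3ℚ)) K≤TL ⟩
      fromℚ 3ℚ * (T * fromℚ L)    ∼⟨ ∀≤⇒≤ _ _ (λ n → ℚ.≤-trans
        (ℚ.≤-reflexive (solve 2 (λ t l → con 3ℚ :* (t :* l) := t :* (con 3ℚ :* l)) refl (seq T n) L))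
        (RationalLemmas.*-monoˡ (seq T n) (0≤T n) 3L≤)) ⟩
      T * fromℚ M                 ∎

    0≤M : 0ℚ ℚ.≤ M
    0≤M = RationalLemmas.0≤+ (nonNeg* 0≤D (ℚ.<⇒≤ 0<K)) (nonNeg* (from-yes (0ℚ ℚ.≤? 2ℚ)) 0≤N)

    -- Multiplying `3K≤TM` by `u * fromℚ D` and using `uTD≤1` eliminates the scaling factor `T`.
    3DKu≤M : (u * fromℚ D) * (fromℚ 3ℚ * fromℚ K) ≤ fromℚ M
    3DKu≤M = begin
      (u * fromℚ D) * (fromℚ 3ℚ * fromℚ K)
        ∼⟨ *-monoˡ-≤ (u * fromℚ D) (proj₁ 0≤u , λ n ≤n → nonNeg* (proj₂ 0≤u n ≤n) 0≤D) 3K≤TM ⟩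
      (u * fromℚ D) * (T * fromℚ M)
        ∼⟨ ∀≡⇒≤ _ _ (λ n → solve 4 (λ u d t m → (u :* d) :* (t :* m) := m :* (u :* (t :* d))) refl
             (seq u n) D (seq T n) M) ⟩
      fromℚ M * (u * (T * fromℚ D))
        ∼⟨ *-monoˡ-≤ (fromℚ M) (always {fromℚ M} λ _ → 0≤M) uTD≤1 ⟩
      fromℚ M * 1ℝ
        ∼⟨ ∀≡⇒≤ _ _ (λ _ → ℚ.*-identityʳ M) ⟩
      fromℚ M ∎

    -- The surplus from having 1/(2 - √2) in place of 3/2; being nonnegative, it can only shrink
    -- when multiplied by `u`.
    excess : ℝ
    excess = fromℚ DK * (v - fromℚ 3/2)

    0≤excess : EventuallyNonNegative excess
    0≤excess = proj₁ 3/2≤v , λ n ≤n → nonNeg* (nonNeg* 0≤D (ℚ.<⇒≤ 0<K))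
      (ℚ.≤-trans (ℚ.≤-reflexive (sym (ℚ.+-inverseʳ 3/2))) (ℚ.+-monoˡ-≤ (ℚ.- 3/2) (proj₂ 3/2≤v n ≤n)))

    -- Splitting `v` as 3/2 plus a remainder separates the left side into a multiple of the quantity
    -- in `3DKu≤M`, the term `excess * u`, and `rest`, which is free of `u`.
    expansion-bound : (1ℝ - (1ℝ - 1ℝ / w [ w#0 ]) / (fromℕ 2 - √2) [ 2-√2#0 ]) * fromℚ D * fromℚ K ≤ fromℚ N
    expansion-bound = begin
      (1ℝ - (1ℝ - 1ℝ * u) * v) * fromℚ D * fromℚ K
        ∼⟨ ∀≡⇒≤ _ _ (λ n → solve 4 (λ u v d k →
             (con 1ℚ :+ :- ((con 1ℚ :+ :- (con 1ℚ :* u)) :* v)) :* d :* k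
             := con ½ :* ((u :* d) :* (con 3ℚ :* k))
                :+ (((d :* k) :* (v :+ :- con 3/2)) :* u
                :+ :- (con ½ :* (d :* k) :+ (d :* k) :* (v :+ :- con 3/2))))
             refl (seq u n) (seq v n) D K) ⟩
      fromℚ ½ * ((u * fromℚ D) * (fromℚ 3ℚ * fromℚ K)) + (excess * u + rest)
        ∼⟨ +-mono-≤ (*-monoˡ-≤ (fromℚ ½) (always {fromℚ ½} λ _ → ℚ.<⇒≤ RationalLemmas.0<½) 3DKu≤M)
             (+-mono-≤ (*-monoˡ-≤ excess 0≤excess u≤1) (≤-refl {rest})) ⟩
      fromℚ ½ * fromℚ M + (excess * 1ℝ + rest)
        -- With `u` bounded by 1 the excess cancels, and half of `M` minus half of `DK` is `N`.
        ∼⟨ ∀≡⇒≤ _ _ (λ n → solve 4 (λ v d k m →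
             con ½ :* (d :* k :+ con 2ℚ :* m) :+ (((d :* k) :* (v :+ :- con 3/2)) :* con 1ℚ
                :+ :- (con ½ :* (d :* k) :+ (d :* k) :* (v :+ :- con 3/2)))
             := m) refl (seq v n) D K N) ⟩
      fromℚ N ∎
      where
      rest : ℝ
      rest = - (fromℚ ½ * fromℚ DK + excess)

-- RIP applied to signed indicator vectors.

module RIPNorms where
  open RationalLemmas using (⌜_⌝)
  open RationalSums
  open Signs

  -- Real addition is termwise, so the norms below can be computed in ℚ at each index.
  seq-∑ : ∀ {k} (x : Vector ℝ k) n → seq (∑ x) n ≡ sum λ i → seq (x i) n
  seq-∑ {zero}  x n = refl
  seq-∑ {suc k} x n = cong (seq (x zero) n ℚ.+_) (seq-∑ (λ i → x (suc i)) n)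

  ⌜toℕ⌝≡𝟙 : ∀ (b : Fin 2) → ⌜ toℕ b ⌝ ≡ 𝟙 (b Fin.≟ one)
  ⌜toℕ⌝≡𝟙 zero       = refl
  ⌜toℕ⌝≡𝟙 (suc zero) = refl

  module _ {m k} (Φ : Matrix (Fin 2) m k) (S : ℝ) (X : Subset k)
           (σ : Vector ℚ k) (signs : ∀ i → IsSign (σ i)) where
    open SignedNeighbourhoods (graph Φ) X

    signedIndicator : Vector ℝ k
    signedIndicator i = fromℚ (𝟙 (i ∈? X) ℚ.* σ i)

    signedIndicator-sparse : ∀ {s} → ∣ X ∣ ℕ.≤ s → Sparse s signedIndicator
    signedIndicator-sparse ∣X∣≤s = X , ∣X∣≤s , λ i i∉X → mk≈ λ ε 0<ε → 0 , λ n _ →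
      subst (λ t → ℚ.∣ t ℚ.- 0ℚ ∣ ℚ.≤ ε)
        (sym (trans (cong (ℚ._* σ i) (𝟙-no (i ∈? X) i∉X)) (ℚ.*-zeroˡ (σ i)))) (ℚ.<⇒≤ 0<ε)

    ‖signedIndicator‖₁ : ∀ n → seq ‖ signedIndicator ‖₁ n ≡ ⌜ ∣ X ∣ ⌝
    ‖signedIndicator‖₁ n = trans (seq-∑ (λ i → abs (signedIndicator i)) n) (trans
      (sum-cong-≗ λ i → trans (∣p*sign∣ (𝟙 (i ∈? X)) (signs i)) (∣𝟙∣ (i ∈? X)))
      (sym (∣p∣≡sum X)))

    -- The scale leaves the norm as `∣ seq S n ∣`, which is nonnegative at every index, as the bound
    -- on `T` in `ExpansionBound` demands.
    ‖SΦ·signedIndicator‖₁ : ∀ n → seq ‖ (S • realMatrix Φ) · signedIndicator ‖₁ n ≡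
      ℚ.∣ seq S n ∣ ℚ.* sum λ j → ℚ.∣ signedDegree σ j ∣
    ‖SΦ·signedIndicator‖₁ n = begin
      seq ‖ (S • realMatrix Φ) · signedIndicator ‖₁ n
        ≡⟨ seq-∑ (λ j → abs (((S • realMatrix Φ) · signedIndicator) j)) n ⟩
      sum (λ j → ℚ.∣ seq (((S • realMatrix Φ) · signedIndicator) j) n ∣)
        ≡⟨ sum-cong-≗ (λ j → trans (cong ℚ.∣_∣ (row j)) (ℚ.∣p*q∣≡∣p∣*∣q∣ (seq S n) (signedDegree σ j))) ⟩
      sum (λ j → ℚ.∣ seq S n ∣ ℚ.* ℚ.∣ signedDegree σ j ∣)
        ≡⟨ *-distribˡ-sum ℚ.∣ seq S n ∣ (λ j → ℚ.∣ signedDegree σ j ∣) ⟨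
      ℚ.∣ seq S n ∣ ℚ.* sum (λ j → ℚ.∣ signedDegree σ j ∣) ∎
      where
      open ≡-Reasoning
      open +-*-Solver using (solve; _:=_; _:*_)
      term : ∀ j i → (seq S n ℚ.* ⌜ toℕ (Φ j i) ⌝) ℚ.* (𝟙 (i ∈? X) ℚ.* σ i) ≡
                     seq S n ℚ.* (incidence i j ℚ.* σ i)
      term j i = begin
        (seq S n ℚ.* ⌜ toℕ (Φ j i) ⌝) ℚ.* (𝟙 (i ∈? X) ℚ.* σ i)
          ≡⟨ cong (λ t → (seq S n ℚ.* t) ℚ.* (𝟙 (i ∈? X) ℚ.* σ i)) (⌜toℕ⌝≡𝟙 (Φ j i)) ⟩
        (seq S n ℚ.* 𝟙 (Φ j i Fin.≟ one)) ℚ.* (𝟙 (i ∈? X) ℚ.* σ i)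
          ≡⟨ solve 4 (λ s a c t → (s :* a) :* (c :* t) := s :* ((c :* a) :* t)) refl
               (seq S n) (𝟙 (Φ j i Fin.≟ one)) (𝟙 (i ∈? X)) (σ i) ⟩
        seq S n ℚ.* ((𝟙 (i ∈? X) ℚ.* 𝟙 (Φ j i Fin.≟ one)) ℚ.* σ i)
          ≡⟨ cong (λ t → seq S n ℚ.* (t ℚ.* σ i)) (𝟙-×-dec (i ∈? X) (Φ j i Fin.≟ one)) ⟨
        seq S n ℚ.* (incidence i j ℚ.* σ i) ∎
      row : ∀ j → seq (((S • realMatrix Φ) · signedIndicator) j) n ≡ seq S n ℚ.* signedDegree σ j
      row j = trans (seq-∑ (λ i → (S • realMatrix Φ) j i * signedIndicator i) n)
        (trans (sum-cong-≗ (term j)) (sym (*-distribˡ-sum (seq S n) (λ i → incidence i j ℚ.* σ i))))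

    open RealOrder

    module _ {s δ} (rip : RIP₁ s δ (S • realMatrix Φ)) (∣X∣≤s : ∣ X ∣ ℕ.≤ s) where
      L : ℚ
      L = sum λ j → ℚ.∣ signedDegree σ j ∣

      rip-lower : fromℕ ∣ X ∣ ≤ abs S * fromℚ L
      rip-lower = begin
        fromℕ ∣ X ∣                               ∼⟨ ∀≡⇒≤ _ _ (λ n → sym (‖signedIndicator‖₁ n)) ⟩
        ‖ signedIndicator ‖₁                      ∼⟨ proj₁ (rip signedIndicator (signedIndicator-sparse ∣X∣≤s)) ⟩
        ‖ (S • realMatrix Φ) · signedIndicator ‖₁ ∼⟨ ∀≡⇒≤ _ _ ‖SΦ·signedIndicator‖₁ ⟩
        abs S * fromℚ L                           ∎
        where open ≤-Reasoning

      rip-upper : abs S * fromℚ L ≤ (1ℝ + δ) * fromℕ ∣ X ∣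
      rip-upper = begin
        abs S * fromℚ L                           ∼⟨ ∀≡⇒≤ _ _ (λ n → sym (‖SΦ·signedIndicator‖₁ n)) ⟩
        ‖ (S • realMatrix Φ) · signedIndicator ‖₁ ∼⟨ proj₂ (rip signedIndicator (signedIndicator-sparse ∣X∣≤s)) ⟩
        (1ℝ + δ) * ‖ signedIndicator ‖₁           ∼⟨ ∀≡⇒≤ _ _ (λ n →
          cong (seq (1ℝ + δ) n ℚ.*_) (‖signedIndicator‖₁ n)) ⟩
        (1ℝ + δ) * fromℕ ∣ X ∣                    ∎
        where open ≤-Reasoning

-- Expansion of every set of at most s columns.

theorem2 : ∀ (m n d s : ℕ) (Φ : Matrix (Fin 2) m n) → (∀ i → onesInColumn Φ i ≡ d) →
    ∀ (δ : ℝ) (1+δ#0 : 1ℝ + δ # 0ℝ) (S : ℝ) → 0ℝ < S → RIP₁ s δ (S • realMatrix Φ) →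
    IsUnbalancedExpander (graph Φ) d s ((1ℝ - 1ℝ / (1ℝ + δ) [ 1+δ#0 ]) / (fromℕ 2 - √2) [ 2-√2#0 ])
theorem2 m n d s Φ regular δ 1+δ#0 S 0<S rip = record
  { left-regular = regular
  ; expands      = λ X ∣X∣≤s → expands X ∣X∣≤s ∣ X ∣ refl
  }
  where
  open RationalLemmas using (⌜_⌝; 0≤⌜⌝; 0<1; ⌜suc⌝)
  open RealOrder
  open RIPNorms
  ε : ℝ
  ε = (1ℝ - 1ℝ / (1ℝ + δ) [ 1+δ#0 ]) / (fromℕ 2 - √2) [ 2-√2#0 ]

  -- The size of `X` is passed as `k` to split off the empty set, where the left side is 0; the main
  -- estimate divides by ∣X∣.
  expands : ∀ X → ∣ X ∣ ℕ.≤ s → ∀ k → ∣ X ∣ ≡ k →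
    (1ℝ - ε) * fromℕ d * fromℕ ∣ X ∣ ≤ fromℕ ∣ BipartiteGraph.neighbourhood (graph Φ) X ∣
  expands X ∣X∣≤s zero ∣X∣≡0 = ∀≤⇒≤ _ _ λ i → subst (ℚ._≤ ⌜ N ⌝)
    (sym (trans (cong (λ k → seq ((1ℝ - ε) * fromℕ d) i ℚ.* ⌜ k ⌝) ∣X∣≡0) (ℚ.*-zeroʳ (seq ((1ℝ - ε) * fromℕ d) i))))
    (0≤⌜⌝ N)
    where
    N : ℕ
    N = ∣ BipartiteGraph.neighbourhood (graph Φ) X ∣
  expands X ∣X∣≤s (suc k) ∣X∣≡ =
    let σ , signs , 3L≤ = balanced regular
    in ExpansionBound.expansion-bound ⌜ d ⌝ ⌜ ∣ X ∣ ⌝ ⌜ N ⌝ _ (0≤⌜⌝ d) 0<∣X∣ (0≤⌜⌝ N) 3L≤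
         (abs S) (1ℝ + δ) 1+δ#0 (λ i → ℚ.0≤∣p∣ (seq S i))
         (rip-lower Φ S X σ signs rip ∣X∣≤s)
         -- The second test vector has all signs +1, and its image has 1-norm ∣S∣ d∣X∣.
         (subst (λ t → fromℕ ∣ X ∣ ≤ abs S * fromℚ t) (sum-signedDegree-1 regular)
           (rip-lower Φ S X (λ _ → 1ℚ) (λ _ → inj₁ refl) rip ∣X∣≤s))
         (subst (λ t → abs S * fromℚ t ≤ (1ℝ + δ) * fromℕ ∣ X ∣) (sum-signedDegree-1 regular)
           (rip-upper Φ S X (λ _ → 1ℚ) (λ _ → inj₁ refl) rip ∣X∣≤s))
    where
    open SignedNeighbourhoods (graph Φ) X
    N : ℕ
    N = ∣ BipartiteGraph.neighbourhood (graph Φ) X ∣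
    0<∣X∣ : 0ℚ ℚ.< ⌜ ∣ X ∣ ⌝
    0<∣X∣ = subst (λ t → 0ℚ ℚ.< ⌜ t ⌝) (sym ∣X∣≡) (subst (0ℚ ℚ.<_) (sym (⌜suc⌝ k))
      (ℚ.+-mono-<-≤ 0<1 (0≤⌜⌝ k)))
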